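{- Let $c_1$ be a real number with $\frac57\le c_1\le 1$, and let $G\in\mathcal{G}$. Then $$\alpha(G)\ge c_1|V_1(G)|+\tfrac{3}{7}|V_2(G)|+(1-c_1)|V_3(G)|-\left(2c_1-\tfrac{8}{7}\right),$$ and this inequality holds with equality for every $G\in\mathcal{B}$. Moreover, if $c_1=\frac57$, then it also holds with equality for every $G\in\mathcal{A}$.
   Context: Graphs are finite, simple and undirected. $\mathcal{G}$ denotes the class of all connected graphs $G$ with maximum degree at most $3$, with $G\neq K_4$ and $|V(G)|\ge 3$. For $i\in\{1,2,3\}$, $V_i(G)=\{v\in V(G): d_G(v)=i\}$, where $d_G(v)$ is the degree of $v$. $\alpha(G)$ is the independence number of $G$. The class $\mathcal{A}$ is defined recursively: $K_3\in\mathcal{A}$; and if $G'\in\mathcal{A}$ and $x$ is a vertex of degree $2$ in $G'$, then the graph obtained from the disjoint union of $G'$ and a triangle $K_3$ by adding one edge between $x$ and a vertex of the triangle belongs to $\mathcal{A}$. The class $\mathcal{B}$ consists of all graphs obtained from a path $P_n$ on $n\ge 2$ vertices by attaching one pendant edge (to a new vertex) at every vertex of $P_n$.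
   Formalization: The parameter c₁ is taken to be a rational number with 5/7 ≤ c₁ ≤ 1 instead of a real number; since the bound is affine in c₁, the real case follows from the endpoints. -}

module Defs where

open import Data.Nat using (ℕ; zero; suc; _≤_)
open import Data.Nat.ListAction using (sum)
open import Data.Bool using (Bool; true; false; if_then_else_; _∨_; _∧_; not)
open import Data.Bool.Properties using (∨-comm)
open import Data.Fin using (Fin; zero; suc; toℕ; splitAt)
open import Data.Fin.Properties using (_≟_)
open import Data.Fin.Subset using (Subset; _∈_; ∣_∣)
open import Data.List using (List; map; allFin)
open import Data.Sum using (_⊎_; inj₁; inj₂)
open import Data.Product using (Σ; _×_; _,_)
open import Data.Integer using (+_)
open import Data.Rational using (ℚ; _/_; _+_; _-_; _*_; 1ℚ)
open import Relation.Nullary using (¬_; yes; no)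
open import Relation.Nullary.Decidable using (⌊_⌋)
open import Relation.Binary.PropositionalEquality using (_≡_; refl; sym)
open import Function.Definitions using (Bijective)

record Graph : Set where
  field
    n      : ℕ
    adj    : Fin n → Fin n → Bool
    adj-sym    : ∀ i j → adj i j ≡ adj j i
    adj-irrefl : ∀ i → adj i i ≡ false
open Graph public

symAdj : ∀ {n} → (Fin n → Fin n → Bool) → Fin n → Fin n → Bool
symAdj e i j = if ⌊ i ≟ j ⌋ then false else (e i j ∨ e j i)

private
  symAdj-sym : ∀ {n} (e : Fin n → Fin n → Bool) i j → symAdj e i j ≡ symAdj e j i
  symAdj-sym e i j with i ≟ j | j ≟ i
  ... | yes _ | yes _ = refl
  ... | yes p | no q = Data.Empty.⊥-elim (q (sym p))
    where import Data.Empty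
  ... | no p | yes q = Data.Empty.⊥-elim (p (sym q))
    where import Data.Empty
  ... | no _ | no _ = ∨-comm (e i j) (e j i)

  symAdj-irrefl : ∀ {n} (e : Fin n → Fin n → Bool) i → symAdj e i i ≡ false
  symAdj-irrefl e i with i ≟ i
  ... | yes _ = refl
  ... | no p = Data.Empty.⊥-elim (p refl)
    where import Data.Empty

mkGraph : (n : ℕ) → (Fin n → Fin n → Bool) → Graph
mkGraph n e = record { n = n ; adj = symAdj e
                     ; adj-sym = symAdj-sym e ; adj-irrefl = symAdj-irrefl e }

b2n : Bool → ℕ
b2n true = 1
b2n false = 0

deg : (G : Graph) → Fin (n G) → ℕ
deg G v = sum (map (λ u → b2n (adj G v u)) (allFin (n G)))

numDeg : (G : Graph) → ℕ → ℕ
numDeg G i = sum (map (λ v → b2n ⌊ deg G v Data.Nat.≟ i ⌋) (allFin (n G)))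
  where import Data.Nat

data Reach (G : Graph) : Fin (n G) → Fin (n G) → Set where
  here : ∀ {u} → Reach G u u
  step : ∀ {u w v} → adj G u w ≡ true → Reach G w v → Reach G u v

Connected : Graph → Set
Connected G = ∀ u v → Reach G u v

Iso : Graph → Graph → Set
Iso G H = Σ (Fin (n G) → Fin (n H)) λ f →
  Bijective _≡_ _≡_ f × (∀ i j → adj G i j ≡ adj H (f i) (f j))

K : ℕ → Graph
K m = mkGraph m (λ _ _ → true)

InClassG : Graph → Set
InClassG G = Connected G × (∀ v → deg G v ≤ 3) × ¬ Iso G (K 4) × 3 ≤ n G

Independent : (G : Graph) → Subset (n G) → Set
Independent G S = ∀ i j → i ∈ S → j ∈ S → adj G i j ≡ false

IsAlpha : Graph → ℕ → Set
IsAlpha G k = Σ (Subset (n G)) (λ S → Independent G S × ∣ S ∣ ≡ k)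
            × (∀ S → Independent G S → ∣ S ∣ ≤ k)

eqᵇ : ∀ {m} → Fin m → Fin m → Bool
eqᵇ i j = ⌊ i ≟ j ⌋

-- disjoint union of G' and a triangle, plus an edge from x to the first
-- triangle vertex.  Old vertices: Fin (n G') (left), triangle: Fin 3 (right).
attachTriangle : (G : Graph) → Fin (n G) → Graph
attachTriangle G x = mkGraph (n G Data.Nat.+ 3) e
  where
  import Data.Nat
  e : Fin (n G Data.Nat.+ 3) → Fin (n G Data.Nat.+ 3) → Bool
  e i j with splitAt (n G) i | splitAt (n G) j
  ... | inj₁ a | inj₁ b = adj G a b
  ... | inj₂ a | inj₂ b = not (eqᵇ a b)
  ... | inj₁ a | inj₂ b = eqᵇ a x ∧ eqᵇ b zero
  ... | inj₂ _ | inj₁ _ = false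

data InA : Graph → Set where
  base : ∀ {G} → Iso G (K 3) → InA G
  grow : ∀ {G G'} → InA G' → (x : Fin (n G')) → deg G' x ≡ 2 →
         Iso G (attachTriangle G' x) → InA G

-- Class ℬ: comb on the path P_m (m ≥ 2) -- vertex i < m is the i-th path
-- vertex, vertex m + i is the pendant vertex attached to path vertex i.

comb : ℕ → Graph
comb m = mkGraph (m Data.Nat.+ m) e
  where
  import Data.Nat
  e : Fin (m Data.Nat.+ m) → Fin (m Data.Nat.+ m) → Bool
  e i j with splitAt m i | splitAt m j
  ... | inj₁ a | inj₁ b = ⌊ suc (toℕ a) Data.Nat.≟ toℕ b ⌋
  ... | inj₁ a | inj₂ b = eqᵇ a b
  ... | _ | _ = false

InB : Graph → Set
InB G = Σ ℕ λ m → 2 ≤ m × Iso G (comb m)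

ℕtoℚ : ℕ → ℚ
ℕtoℚ k = + k / 1

bound : ℚ → Graph → ℚ
bound c₁ G = c₁ * ℕtoℚ (numDeg G 1) + (+ 3 / 7) * ℕtoℚ (numDeg G 2)
           + (1ℚ - c₁) * ℕtoℚ (numDeg G 3) - (+ 2 / 1 * c₁ - + 8 / 7)

{-# OPTIONS --safe #-}
-- The bound is affine in c₁, so it suffices to treat t = 7 c₁ − 4 ∈ {1, 3}.
-- Give a vertex of degree d the weight w d = 7 + 2t, 4 + t, 3, 3 − t for
-- d = 0, 1, 2, 3, and write d_S for the degree inside a vertex set S.  By
-- induction on |S|, every connected S other than a single edge satisfies
--   7 α(S) + 2t ≥ Σ_{v ∈ S} w (d_S v).
-- Since w grows by at least t when the degree drops by one, a component C of
-- R ⊊ S joined to the rest of S by e ≥ 1 edges loses at most 2t − te ≤ te, so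
--   7 α(R) + t e(R, S ∖ R) ≥ Σ_{v ∈ R} w (d_S v),
-- without the term t e(R, S ∖ R) if S has no bridge.  In the bridgeless case
-- delete the closed neighbourhood of a vertex of minimum degree d and use
-- (d + 1) w d ≤ 7 + 2t.  For a bridge uv with sides A ∋ u and B ∋ v, one of
-- α(A) + α(B ∖ v) and α(A ∖ u) + α(B) is large enough: the first if removing v
-- does not lower α(B), the second because otherwise B gains 7 over B ∖ v.
-- For the cases of equality, combs and triangle trees have the independent sets
-- of leaves, resp. of one vertex per triangle, which are optimal since the
-- vertices are partitioned into edges, resp. triangles.
module Submission where

open import Defs
open import Data.Nat using (ℕ)
open import Data.Product using (_×_; _,_; proj₁; proj₂; ∃)
open import Data.Sum using (_⊎_; inj₁; inj₂; [_,_]′)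
open import Relation.Binary.PropositionalEquality hiding (J)

module IndependentSets where

  open import Data.Bool using (Bool; true; false; if_then_else_; _∨_; _∧_; not; T)
  import Data.Bool.Properties as Bool
  open import Data.Empty using (⊥; ⊥-elim)
  open import Data.Fin using (Fin; zero; suc; toℕ; splitAt; _↑ˡ_; _↑ʳ_)
  import Data.Fin.Properties as Fin
  open import Data.Fin.Properties using (any?; all?; splitAt-↑ˡ; splitAt-↑ʳ; ↑ˡ-injective; ↑ʳ-injective; toℕ<n)
    renaming (_≟_ to _≟F_)
  open import Data.Fin.Subset using (Subset; ∣_∣)
  open import Data.Fin.Subset.Properties using (anySubset?)
  import Data.List as List
  open import Data.List.Properties using (map-tabulate)
  open import Data.Nat using (zero; suc; _+_; _*_; _∸_; _≤_; _<_; z≤n; s≤s; _≤?_; _<?_; _≟_; _≤ᵇ_; _<ᵇ_; _≡ᵇ_)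
  import Data.Nat.ListAction as ℕList
  open import Data.Nat.Properties
  open import Data.Nat.Tactic.RingSolver using (solve-∀)
  open import Data.Vec using ([]; _∷_; lookup; tabulate)
  open import Data.Vec.Properties using (lookup∘tabulate; []=⇒lookup; lookup⇒[]=)
  open import Function using (_∘_; id; Bijective; mk⤖; Inverse)
  open import Function.Properties.Bijection using (⤖⇒↔)
  open import Relation.Nullary using (¬_; Dec; yes; no; does; contradiction)
  open import Relation.Nullary.Decidable using (⌊_⌋; _×-dec_; _→-dec_; map′; from-yes)
  open import Algebra.Properties.CommutativeMonoid.Sum +-0-commutativeMonoid
    using (sum; sum-cong-≗; ∑-distrib-+; ∑-comm; sum-permute)
  open import Algebra.Properties.Semiring.Sum +-*-semiring using (*-distribˡ-sum; *-distribʳ-sum)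

  -- Vertex sets as Boolean predicates, and their disjoint unions.

  VSet : ℕ → Set
  VSet n = Fin n → Bool

  infix 4 _∈_ _∉_ _⊆_
  infixl 6 _∖_ _∪_

  _∈_ _∉_ : ∀ {n} → Fin n → VSet n → Set
  i ∈ R = R i ≡ true
  i ∉ R = R i ≡ false

  _⊆_ : ∀ {n} → VSet n → VSet n → Set
  R ⊆ S = ∀ i → i ∈ R → i ∈ S

  _∖_ _∪_ : ∀ {n} → VSet n → VSet n → VSet n
  (S ∖ R) i = S i ∧ not (R i)
  (S ∪ R) i = S i ∨ R i

  ⁅_⁆ : ∀ {n} → Fin n → VSet n
  ⁅ u ⁆ i = does (i ≟F u)

  -- Disjoint union, stated additively so that sums over R split termwise.
  _≐_⊎_ : ∀ {n} → VSet n → VSet n → VSet n → Set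
  R ≐ D ⊎ E = ∀ i → b2n (R i) ≡ b2n (D i) + b2n (E i)

  infix 4 _≐_⊎_

  ∈⁅⁆ : ∀ {n} (u : Fin n) → u ∈ ⁅ u ⁆
  ∈⁅⁆ u with u ≟F u
  ... | yes _ = refl
  ... | no ¬p = contradiction refl ¬p

  ∈⁅⁆⇒≡ : ∀ {n} (u i : Fin n) → i ∈ ⁅ u ⁆ → i ≡ u
  ∈⁅⁆⇒≡ u i p with i ≟F u
  ... | yes q = q

  ⁅⁆⊆ : ∀ {n} (R : VSet n) {u} → u ∈ R → ⁅ u ⁆ ⊆ R
  ⁅⁆⊆ R {u} u∈R i i∈ = subst (_∈ R) (sym (∈⁅⁆⇒≡ u i i∈)) u∈R

  ∈-∖⁻ : ∀ {n} (S R : VSet n) {i} → i ∈ S ∖ R → i ∈ S × i ∉ R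
  ∈-∖⁻ S R {i} p with S i | R i
  ... | true | false = refl , refl

  ∈-∖⁺ : ∀ {n} (S R : VSet n) {i} → i ∈ S → i ∉ R → i ∈ S ∖ R
  ∈-∖⁺ S R p q rewrite p | q = refl

  ∈-∪⁻ : ∀ {n} (S R : VSet n) {i} → i ∈ S ∪ R → i ∈ S ⊎ i ∈ R
  ∈-∪⁻ S R {i} p with S i
  ... | true = inj₁ refl
  ... | false = inj₂ p

  ∈⇒∉∖ : ∀ {n} (S R : VSet n) {i} → i ∈ R → i ∉ S ∖ R
  ∈⇒∉∖ S R {i} i∈R = trans (cong (λ b → S i ∧ not b) i∈R) (Bool.∧-zeroʳ (S i))

  ∖⊆ : ∀ {n} (S R : VSet n) → S ∖ R ⊆ S
  ∖⊆ S R i p = proj₁ (∈-∖⁻ S R p)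

  ∉⇒¬∈ : ∀ {n} (R : VSet n) {i} → i ∉ R → ¬ i ∈ R
  ∉⇒¬∈ R p q with () ← trans (sym p) q

  ¬∈⇒∉ : ∀ {n} (R : VSet n) {i} → ¬ i ∈ R → i ∉ R
  ¬∈⇒∉ R = Bool.¬-not

  ≐-∖ : ∀ {n} {R D : VSet n} → D ⊆ R → R ≐ D ⊎ R ∖ D
  ≐-∖ {R = R} {D} D⊆R i = go (R i) (D i) (D⊆R i)
    where
    go : ∀ r d → (d ≡ true → r ≡ true) → b2n r ≡ b2n d + b2n (r ∧ not d)
    go true true _ = refl
    go true false _ = refl
    go false false _ = refl
    go false true f with () ← f refl

  ≐-∪ : ∀ {n} (D E : VSet n) → (∀ i → i ∈ D → i ∈ E → ⊥) → D ∪ E ≐ D ⊎ E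
  ≐-∪ D E disjoint i = go (D i) (E i) (disjoint i)
    where
    go : ∀ d e → (d ≡ true → e ≡ true → ⊥) → b2n (d ∨ e) ≡ b2n d + b2n e
    go true true f = ⊥-elim (f refl refl)
    go true false f = refl
    go false e f = refl

  ≐-comm : ∀ {n} {R D E : VSet n} → R ≐ D ⊎ E → R ≐ E ⊎ D
  ≐-comm {D = D} {E} p i = trans (p i) (+-comm (b2n (D i)) (b2n (E i)))

  ≐⇒⊆ˡ : ∀ {n} {R D E : VSet n} → R ≐ D ⊎ E → D ⊆ R
  ≐⇒⊆ˡ {R = R} {D} {E} p i i∈D with R i | D i | E i | p i
  ... | true | true | _ | _ = refl

  ≐⇒⊆ʳ : ∀ {n} {R D E : VSet n} → R ≐ D ⊎ E → E ⊆ R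
  ≐⇒⊆ʳ {R = R} {D} {E} p = ≐⇒⊆ˡ {R = R} {E} {D} (≐-comm {R = R} {D} {E} p)

  ≐⇒disjoint : ∀ {n} {R D E : VSet n} → R ≐ D ⊎ E → ∀ i → i ∈ D → i ∈ E → ⊥
  ≐⇒disjoint {R = R} {D} {E} p i i∈D i∈E with R i | D i | E i | p i
  ... | true | true | true | ()
  ... | false | true | true | ()

  ≐⇒∖ : ∀ {n} {R D E : VSet n} → R ≐ D ⊎ E → ∀ i → (R ∖ D) i ≡ E i
  ≐⇒∖ {R = R} {D} {E} p i with R i | D i | E i | p i
  ... | true | true | false | _ = refl
  ... | true | false | true | _ = refl
  ... | false | false | false | _ = refl

  ∖-∖ : ∀ {n} {S R D : VSet n} → D ⊆ R → R ⊆ S → S ∖ D ≐ R ∖ D ⊎ S ∖ R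
  ∖-∖ {S = S} {R} {D} D⊆R R⊆S i = go (S i) (R i) (D i) (D⊆R i) (R⊆S i)
    where
    go : ∀ s r d → (d ≡ true → r ≡ true) → (r ≡ true → s ≡ true) →
         b2n (s ∧ not d) ≡ b2n (r ∧ not d) + b2n (s ∧ not r)
    go true true true f g = refl
    go true true false f g = refl
    go true false true f g with () ← f refl
    go true false false f g = refl
    go false true d f g with () ← g refl
    go false false d f g = refl

  ∖-∖-∖ : ∀ {n} {S R D : VSet n} → D ⊆ R → R ⊆ S → S ∖ (R ∖ D) ≐ D ⊎ S ∖ R
  ∖-∖-∖ {S = S} {R} {D} D⊆R R⊆S i = go (S i) (R i) (D i) (D⊆R i) (R⊆S i)
    where
    go : ∀ s r d → (d ≡ true → r ≡ true) → (r ≡ true → s ≡ true) →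
         b2n (s ∧ not (r ∧ not d)) ≡ b2n d + b2n (s ∧ not r)
    go true true true f g = refl
    go true true false f g = refl
    go true false true f g with () ← f refl
    go true false false f g = refl
    go false true d f g with () ← g refl
    go false false true f g with () ← f refl
    go false false false f g = refl

  -- Sums over vertex sets.

  ∑∈ : ∀ {n} → VSet n → (Fin n → ℕ) → ℕ
  ∑∈ R f = sum (λ i → if R i then f i else 0)

  card : ∀ {n} → VSet n → ℕ
  card R = ∑∈ R (λ _ → 1)

  sum-mono : ∀ {n} {f g : Fin n → ℕ} → (∀ i → f i ≤ g i) → sum f ≤ sum g
  sum-mono {zero} h = z≤n
  sum-mono {suc n} h = +-mono-≤ (h zero) (sum-mono (h ∘ suc))

  sum-zero : ∀ {n} {f : Fin n → ℕ} → (∀ i → f i ≡ 0) → sum f ≡ 0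
  sum-zero {zero} h = refl
  sum-zero {suc n} h = cong₂ _+_ (h zero) (sum-zero (h ∘ suc))

  sum-const : ∀ n c → sum {n} (λ _ → c) ≡ n * c
  sum-const zero c = refl
  sum-const (suc n) c = cong (c +_) (sum-const n c)

  ∑∈-congˡ : ∀ {n} {R R′ : VSet n} (f : Fin n → ℕ) → (∀ i → R i ≡ R′ i) → ∑∈ R f ≡ ∑∈ R′ f
  ∑∈-congˡ f h = sum-cong-≗ λ i → cong (if_then f i else 0) (h i)

  ∑∈-mono : ∀ {n} {R : VSet n} {f g : Fin n → ℕ} → (∀ i → i ∈ R → f i ≤ g i) → ∑∈ R f ≤ ∑∈ R g
  ∑∈-mono {R = R} {f} {g} h = sum-mono λ i → go (R i) (h i)
    where
    go : ∀ r {x y} → (r ≡ true → x ≤ y) → (if r then x else 0) ≤ (if r then y else 0)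
    go true k = k refl
    go false k = z≤n

  ∑∈-cong : ∀ {n} {R : VSet n} {f g : Fin n → ℕ} → (∀ i → i ∈ R → f i ≡ g i) → ∑∈ R f ≡ ∑∈ R g
  ∑∈-cong {R = R} h = ≤-antisym
    (∑∈-mono {R = R} λ i p → ≤-reflexive (h i p))
    (∑∈-mono {R = R} λ i p → ≤-reflexive (sym (h i p)))

  ∑∈-+ : ∀ {n} (R : VSet n) (f g : Fin n → ℕ) → ∑∈ R (λ i → f i + g i) ≡ ∑∈ R f + ∑∈ R g
  ∑∈-+ R f g = trans (sum-cong-≗ λ i → go (R i) (f i) (g i))
    (∑-distrib-+ (λ i → if R i then f i else 0) (λ i → if R i then g i else 0))
    where
    go : ∀ r x y → (if r then x + y else 0) ≡ (if r then x else 0) + (if r then y else 0)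
    go true x y = refl
    go false x y = refl

  ∑∈-*ˡ : ∀ {n} (R : VSet n) c (f : Fin n → ℕ) → ∑∈ R (λ i → c * f i) ≡ c * ∑∈ R f
  ∑∈-*ˡ R c f = sym (trans (*-distribˡ-sum c (λ i → if R i then f i else 0)) (sum-cong-≗ λ i → go (R i) (f i)))
    where
    go : ∀ r x → c * (if r then x else 0) ≡ (if r then c * x else 0)
    go true x = refl
    go false x = *-zeroʳ c

  ∑∈-⊎ : ∀ {n} {R D E : VSet n} → R ≐ D ⊎ E → ∀ f → ∑∈ R f ≡ ∑∈ D f + ∑∈ E f
  ∑∈-⊎ {R = R} {D} {E} p f = trans (sum-cong-≗ λ i → go (R i) (D i) (E i) (f i) (p i))
    (∑-distrib-+ (λ i → if D i then f i else 0) (λ i → if E i then f i else 0))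
    where
    go : ∀ r d e x → b2n r ≡ b2n d + b2n e →
         (if r then x else 0) ≡ (if d then x else 0) + (if e then x else 0)
    go true true false x q = sym (+-identityʳ x)
    go true false true x q = refl
    go false false false x q = refl

  ∑∈-⁅⁆ : ∀ {n} (u : Fin n) f → ∑∈ ⁅ u ⁆ f ≡ f u
  ∑∈-⁅⁆ {suc m} zero f = trans (cong (f zero +_)
    (sum-zero {f = λ i → if ⁅ zero {n = m} ⁆ (suc i) then f (suc i) else 0} λ _ → refl)) (+-identityʳ _)
  ∑∈-⁅⁆ (suc u) f = ∑∈-⁅⁆ u (f ∘ suc)

  ∑∈-remove : ∀ {n} (R : VSet n) {u} → u ∈ R → ∀ f → ∑∈ R f ≡ f u + ∑∈ (R ∖ ⁅ u ⁆) f
  ∑∈-remove R {u} u∈R f = trans (∑∈-⊎ (≐-∖ (⁅⁆⊆ R u∈R)) f) (cong (_+ ∑∈ (R ∖ ⁅ u ⁆) f) (∑∈-⁅⁆ u f))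

  ∑∈-∅ : ∀ {n} {R : VSet n} → (∀ i → ¬ i ∈ R) → ∀ f → ∑∈ R f ≡ 0
  ∑∈-∅ {R = R} h f = sum-zero λ i → cong (if_then f i else 0) (¬∈⇒∉ R (h i))

  ∑∈-bound : ∀ {n} (R : VSet n) {u} → u ∈ R → ∀ f → f u ≤ ∑∈ R f
  ∑∈-bound R u∈R f = ≤-trans (m≤m+n _ _) (≤-reflexive (sym (∑∈-remove R u∈R f)))

  ∑∈-⊆ : ∀ {n} {R S : VSet n} → R ⊆ S → ∀ f → ∑∈ R f ≤ ∑∈ S f
  ∑∈-⊆ R⊆S f = ≤-trans (m≤m+n _ _) (≤-reflexive (sym (∑∈-⊎ (≐-∖ R⊆S) f)))

  ∑∈-positive : ∀ {n} (R : VSet n) f → 0 < ∑∈ R f → ∃ λ u → u ∈ R × 0 < f u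
  ∑∈-positive R f pos with any? (λ u → (R u Bool.≟ true) ×-dec (0 <? f u))
  ... | yes p = p
  ... | no ¬p = contradiction (subst (0 <_) (trans (∑∈-cong {R = R} zeros) (∑∈-zeros)) pos) (<-irrefl refl)
    where
    zeros : ∀ i → i ∈ R → f i ≡ 0
    zeros i i∈R = n≤0⇒n≡0 (≮⇒≥ λ q → ¬p (i , i∈R , q))
    ∑∈-zeros : ∑∈ R (λ _ → 0) ≡ 0
    ∑∈-zeros = sum-zero λ i → Bool.if-eta (R i)

  -- Applied to the edge count across a bridge: `u` is the endpoint of the bridge in `R`, and no
  -- other vertex of `R` has a neighbour on the far side.
  ∑∈≡1 : ∀ {n} (R : VSet n) f → ∑∈ R f ≡ 1 →
         ∃ λ u → u ∈ R × f u ≡ 1 × ∑∈ (R ∖ ⁅ u ⁆) f ≡ 0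
  ∑∈≡1 R f eq with u , u∈R , pos ← ∑∈-positive R f (≤-reflexive (sym eq)) =
    u , u∈R , go (f u) _ pos (trans (sym (∑∈-remove R u∈R f)) eq)
    where
    go : ∀ x y → 0 < x → x + y ≡ 1 → x ≡ 1 × y ≡ 0
    go (suc zero) y _ q = refl , suc-injective q

  card-< : ∀ {n} {R S : VSet n} → R ⊆ S → ∃ (_∈ S ∖ R) → card R < card S
  card-< {R = R} {S} R⊆S (i , i∈) = ≤-trans (≤-reflexive (+-comm 1 _))
    (≤-trans (+-monoʳ-≤ (card R) (∑∈-bound (S ∖ R) i∈ _)) (≤-reflexive (sym (∑∈-⊎ (≐-∖ R⊆S) _))))

  argmin : ∀ {n} {S : VSet n} (f : Fin n → ℕ) → ∃ (_∈ S) → ∃ λ v → v ∈ S × (∀ i → i ∈ S → f v ≤ f i)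
  argmin {S = S} f (v₀ , v₀∈S) = go (f v₀) v₀ v₀∈S ≤-refl
    where
    -- `m` bounds the value at the current candidate, so each strict improvement lowers it.
    go : ∀ m v → v ∈ S → f v ≤ m → ∃ λ v → v ∈ S × (∀ i → i ∈ S → f v ≤ f i)
    go m v v∈S fv≤m with any? (λ i → (S i Bool.≟ true) ×-dec (f i <? f v))
    ... | no ¬p = v , v∈S , λ i i∈S → ≮⇒≥ λ lt → ¬p (i , i∈S , lt)
    ... | yes (i , i∈S , lt) with m
    ...   | zero = contradiction (≤-trans lt fv≤m) λ ()
    ...   | suc m = go m i i∈S (≤-pred (≤-trans lt fv≤m))

  -- The weights and their finite inequalities.

  evident : ∀ m n {_ : T (m ≤ᵇ n)} → m ≤ n
  evident m n {p} = ≤ᵇ⇒≤ m n p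

  -- These are the values of t = 7 c₁ - 4 at the two ends c₁ = 5/7 and c₁ = 1.
  data Scale : ℕ → Set where
    one   : Scale 1
    three : Scale 3

  -- At degrees 1, 2, 3 these are 7 times the coefficients of the bound, as 7 c₁ = t + 4 and 7 (1 -
  -- c₁) = 3 - t. The value at 0 makes the inequality sharp for a single vertex.
  w : ℕ → ℕ → ℕ
  w t 0 = 7 + 2 * t
  w t 1 = 4 + t
  w t 2 = 3
  w t _ = 3 ∸ t

  -- The successive drops of `w t` are t + 3, t + 1 and t, each at least t. All variables are
  -- bounded, so the proof evaluates a decision procedure on the finite table, as do the next two
  -- lemmas.
  w-drop : ∀ {t} → Scale t → ∀ d x → d + x ≤ 3 → w t (d + x) + t * x ≤ w t d
  w-drop {t} sc d x d+x≤3 = table sc (s≤s (≤-trans (m≤m+n d x) d+x≤3)) (s≤s (≤-trans (m≤n+m x d) d+x≤3)) d+x≤3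
    where
    Table : ℕ → Set
    Table t = ∀ {d} → d < 4 → ∀ {x} → x < 4 → d + x ≤ 3 → w t (d + x) + t * x ≤ w t d
    table? : ∀ t → Dec (Table t)
    table? t = allUpTo? (λ d → allUpTo? (λ x → (d + x ≤? 3) →-dec (w t (d + x) + t * x ≤? w t d)) 4) 4
    table : ∀ {t} → Scale t → Table t
    table one = from-yes (table? 1)
    table three = from-yes (table? 3)

  -- The case of a component K₂ of R whose ends have x and y neighbours in S ∖ R.
  w-pair : ∀ {t} → Scale t → ∀ κ x y → κ ≤ 1 → suc x ≤ 3 → suc y ≤ 3 → κ < x + y →
           w t (suc x) + w t (suc y) ≤ 7 * 1 + (1 ∸ κ) * (t * (x + y))
  w-pair {t} sc κ x y κ≤1 x≤2 y≤2 = table sc (s≤s κ≤1) x≤2 y≤2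
    where
    Table : ℕ → Set
    Table t = ∀ {κ} → κ < 2 → ∀ {x} → x < 3 → ∀ {y} → y < 3 → κ < x + y →
              w t (suc x) + w t (suc y) ≤ 7 * 1 + (1 ∸ κ) * (t * (x + y))
    table? : ∀ t → Dec (Table t)
    table? t = allUpTo? (λ κ → allUpTo? (λ x → allUpTo? (λ y → (κ <? x + y) →-dec
                 (w t (suc x) + w t (suc y) ≤? 7 * 1 + (1 ∸ κ) * (t * (x + y)))) 3) 3) 2
    table : ∀ {t} → Scale t → Table t
    table one = from-yes (table? 1)
    table three = from-yes (table? 3)

  -- For d = 0, 2, 3 the left side is 7 + 2t, 9 and 4 (3 - t). Degree 1 would give 8 + 2t, which is
  -- too large by one.
  w-star : ∀ {t} → Scale t → ∀ d → d ≤ 3 → d ≢ 1 → w t d + d * w t d ≤ 7 + 2 * t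
  w-star sc d d≤3 d≢1 = table sc (s≤s d≤3) d≢1
    where
    Table : ℕ → Set
    Table t = ∀ {d} → d < 4 → (d ≡ 1 → ⊥) → w t d + d * w t d ≤ 7 + 2 * t
    table? : ∀ t → Dec (Table t)
    table? t = allUpTo? (λ d → ((d ≟ 1) →-dec (no λ ())) →-dec (w t d + d * w t d ≤? 7 + 2 * t)) 4
    table : ∀ {t} → Scale t → Table t
    table one = from-yes (table? 1)
    table three = from-yes (table? 3)

  -- The endpoint of a bridge has degree e + 1 in S, hence degree e on its own side.
  w-end : ∀ {t} → Scale t → ∀ e → suc e ≤ 3 →
          w t (suc e) + t * e ≤ t + 3 ⊎ (w t (suc e) + t * e ≤ t + 4 × e ≡ 0)
  w-end {t} sc 0 _ = inj₂ (≤-reflexive (lemma t) , refl)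
    where
    lemma : ∀ t → 4 + t + t * 0 ≡ t + 4
    lemma = solve-∀
  w-end {t} sc 1 _ = inj₁ (≤-reflexive (lemma t))
    where
    lemma : ∀ t → 3 + t * 1 ≡ t + 3
    lemma = solve-∀
  w-end one 2 _ = inj₁ ≤-refl
  w-end three 2 _ = inj₁ ≤-refl
  w-end sc (suc (suc (suc _))) (s≤s (s≤s (s≤s ())))

  -- Edge counts, independent sets and cuts in a subcubic graph.

  module SubcubicGraph
    {n : ℕ} (a : Fin n → Fin n → Bool)
    (a-sym : ∀ i j → a i j ≡ a j i) (a-irrefl : ∀ i → a i i ≡ false)
    (subcubic : ∀ v → sum (λ u → b2n (a v u)) ≤ 3)
    {t : ℕ} (scale : Scale t)
    where

    deg∈ : VSet n → Fin n → ℕ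
    deg∈ X v = ∑∈ X (λ u → b2n (a v u))

    -- Adjacent ordered pairs are counted, which is the number of edges between `A` and `X` when
    -- these are disjoint.
    edges : VSet n → VSet n → ℕ
    edges A X = ∑∈ A (deg∈ X)

    weight : VSet n → VSet n → ℕ
    weight S R = ∑∈ R (λ v → w t (deg∈ S v))

    edges-+ˡ : ∀ {A D E} → A ≐ D ⊎ E → ∀ X → edges A X ≡ edges D X + edges E X
    edges-+ˡ p X = ∑∈-⊎ p (deg∈ X)

    edges-+ʳ : ∀ {X D E} → X ≐ D ⊎ E → ∀ A → edges A X ≡ edges A D + edges A E
    edges-+ʳ p A = trans (∑∈-cong {R = A} λ i _ → ∑∈-⊎ p _) (∑∈-+ A _ _)

    edges-congʳ : ∀ {X Y} → (∀ i → X i ≡ Y i) → ∀ A → edges A X ≡ edges A Y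
    edges-congʳ h A = ∑∈-cong {R = A} λ i _ → ∑∈-congˡ _ h

    edges-sym : ∀ A X → edges A X ≡ edges X A
    -- Double counting: the membership test for `A` is pulled into the inner sum, the two sums are
    -- exchanged, and `a-sym` matches the terms.
    edges-sym A X = trans (sum-cong-≗ λ i → pull (A i) _) (trans
      (∑-comm (λ i j → if A i then (if X j then b2n (a i j) else 0) else 0))
      (sym (trans (sum-cong-≗ λ j → pull (X j) _)
        (sum-cong-≗ λ j → sum-cong-≗ λ i → swap (A i) (X j) (a-sym j i)))))
      where
      pull : ∀ (b : Bool) (f : Fin n → ℕ) → (if b then sum f else 0) ≡ sum (λ i → if b then f i else 0)
      pull true f = refl
      pull false f = sym (sum-zero {n} {λ _ → 0} λ _ → refl)
      swap : ∀ b c {x y} → x ≡ y →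
        (if c then (if b then b2n x else 0) else 0) ≡ (if b then (if c then b2n y else 0) else 0)
      swap true true p = cong b2n p
      swap true false p = refl
      swap false true p = refl
      swap false false p = refl

    edges-⁅⁆ : ∀ u X → edges ⁅ u ⁆ X ≡ deg∈ X u
    edges-⁅⁆ u X = ∑∈-⁅⁆ u (deg∈ X)

    edges≡0⇒nonadjacent : ∀ A X → edges A X ≡ 0 → ∀ i j → i ∈ A → j ∈ X → a i j ≡ false
    edges≡0⇒nonadjacent A X eq i j i∈A j∈X =
      b2n≤0 (≤-trans (∑∈-bound X j∈X _) (≤-trans (∑∈-bound A i∈A (deg∈ X)) (≤-reflexive eq)))
      where
      b2n≤0 : ∀ {b} → b2n b ≤ 0 → b ≡ false
      b2n≤0 {false} _ = refl

    deg∈≤3 : ∀ X v → deg∈ X v ≤ 3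
    deg∈≤3 X v = ≤-trans (sum-mono λ u → lemma (X u) _) (subcubic v)
      where
      lemma : ∀ b x → (if b then x else 0) ≤ x
      lemma true x = ≤-refl
      lemma false x = z≤n

    -- A witness for α(R) ≥ k. The induction only builds independent sets of known size; maximality
    -- enters at the end, for the whole graph.
    record HasIndependent (R : VSet n) (k : ℕ) : Set where
      constructor independent
      field
        set : VSet n
        set⊆ : set ⊆ R
        nonadjacent : ∀ i j → i ∈ set → j ∈ set → a i j ≡ false
        card≡ : card set ≡ k

    independent-⁅⁆ : ∀ R {v} → v ∈ R → HasIndependent R 1
    independent-⁅⁆ R {v} v∈R = independent ⁅ v ⁆ (⁅⁆⊆ R v∈R)
      (λ i j i∈ j∈ → trans (cong₂ a (∈⁅⁆⇒≡ v i i∈) (∈⁅⁆⇒≡ v j j∈)) (a-irrefl v)) (∑∈-⁅⁆ v _)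

    independent-∪ : ∀ {A B S k l} → A ⊆ S → B ⊆ S → (∀ i → i ∈ A → i ∈ B → ⊥) →
      (∀ i j → i ∈ A → j ∈ B → a i j ≡ false) →
      HasIndependent A k → HasIndependent B l → HasIndependent S (k + l)
    independent-∪ A⊆S B⊆S disjoint no-edge (independent I I⊆A I-ind refl) (independent J J⊆B J-ind refl) =
      independent (I ∪ J)
        (λ i i∈ → [ A⊆S i ∘ I⊆A i , B⊆S i ∘ J⊆B i ]′ (∈-∪⁻ I J i∈))
        (λ i j i∈ j∈ → ind i j (∈-∪⁻ I J i∈) (∈-∪⁻ I J j∈))
        (∑∈-⊎ (≐-∪ I J λ i i∈I i∈J → disjoint i (I⊆A i i∈I) (J⊆B i i∈J)) _)
      where
      ind : ∀ i j → i ∈ I ⊎ i ∈ J → j ∈ I ⊎ j ∈ J → a i j ≡ false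
      ind i j (inj₁ p) (inj₁ q) = I-ind i j p q
      ind i j (inj₁ p) (inj₂ q) = no-edge i j (I⊆A i p) (J⊆B j q)
      ind i j (inj₂ p) (inj₁ q) = trans (a-sym i j) (no-edge j i (I⊆A j q) (J⊆B i p))
      ind i j (inj₂ p) (inj₂ q) = J-ind i j p q

    -- Connectivity is expressed by cuts instead of paths: `S` is connected if it has no cut with κ
    -- = 0, and connected and bridgeless if it has none with κ = 1.
    record Cut (κ : ℕ) (S D : VSet n) : Set where
      constructor cut
      field
        side⊆ : D ⊆ S
        inhabited : ∃ (_∈ D)
        proper : ∃ (_∈ S ∖ D)
        few-edges : edges D (S ∖ D) ≤ κ

    Uncut : ℕ → VSet n → Set
    Uncut κ S = ∀ D → ¬ Cut κ S D

    uncut⇒edges : ∀ {κ S} → Uncut κ S → ∀ {D} → D ⊆ S → ∃ (_∈ D) → ∃ (_∈ S ∖ D) → κ < edges D (S ∖ D)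
    uncut⇒edges uncut {D} D⊆S inh prop = ≰⇒> λ few → uncut D (cut D⊆S inh prop few)

    inhabited? : ∀ (R : VSet n) → Dec (∃ (_∈ R))
    inhabited? R = any? (λ i → R i Bool.≟ true)

    cut? : ∀ κ S → (∃ λ D → Cut κ S D) ⊎ Uncut κ S
    cut? κ S with anySubset? (λ s → dec (lookup s))
      where
      dec : ∀ D → Dec (Cut κ S D)
      dec D = map′ (λ (p , q , r , s) → cut p q r s) (λ (cut p q r s) → p , q , r , s)
        (all? (λ i → (D i Bool.≟ true) →-dec (S i Bool.≟ true)) ×-dec inhabited? D
          ×-dec inhabited? (S ∖ D) ×-dec (edges D (S ∖ D) ≤? κ))
    ... | yes (s , c) = inj₁ (lookup s , c)
    ... | no ¬c = inj₂ λ D c → ¬c (tabulate D , respects (λ i → sym (lookup∘tabulate D i)) c)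
      where
      -- The search runs over vectors, and a predicate agrees with the lookup of its tabulation only
      -- pointwise, so a cut has to be carried along pointwise equality.
      respects : ∀ {D D′} → (∀ i → D i ≡ D′ i) → Cut κ S D → Cut κ S D′
      respects {D} {D′} h (cut p (i , q) (j , r) s) = cut
        (λ i i∈ → p i (trans (h i) i∈)) (i , trans (sym (h i)) q)
        (j , trans (sym (h∖ j)) r)
        (≤-trans (≤-reflexive (trans (sym (∑∈-congˡ (deg∈ (S ∖ D′)) h))
          (edges-congʳ (sym ∘ h∖) D))) s)
        where
        h∖ : ∀ i → (S ∖ D) i ≡ (S ∖ D′) i
        h∖ i = cong (λ b → S i ∧ not b) (h i)

    record Edge (S : VSet n) : Set where
      constructor edge
      field
        {u v} : Fin n
        adjacent : a u v ≡ true
        u∈ : u ∈ S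
        v∈ : v ∈ S
        only : ∀ i → i ∈ S → i ≡ u ⊎ i ≡ v

    -- A single edge has total weight 2 (4 + t) = 8 + 2t, one more than 7 · 1 + 2t, hence the
    -- exceptional alternative.
    Bound : VSet n → Set
    Bound S = ∃ (_∈ S) → Uncut 0 S →
      Edge S ⊎ ∃ λ k → HasIndependent S k × weight S S ≤ 7 * k + 2 * t

    ∑∈-Edge : ∀ {S} (E : Edge S) f → ∑∈ S f ≡ f (Edge.u E) + f (Edge.v E)
    ∑∈-Edge {S} (edge {u} {v} adj u∈ v∈ only) f = trans (∑∈-remove S u∈ f) (cong (f u +_)
      (trans (∑∈-remove S∖u v∈′ f) (trans (cong (f v +_) (∑∈-∅ empty f)) (+-identityʳ _))))
      where
      S∖u = S ∖ ⁅ u ⁆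
      v≢u : v ≢ u
      v≢u refl with () ← trans (sym (a-irrefl u)) adj
      v∈′ : v ∈ S∖u
      v∈′ = ∈-∖⁺ S ⁅ u ⁆ v∈ (¬∈⇒∉ ⁅ u ⁆ {v} (v≢u ∘ ∈⁅⁆⇒≡ u v))
      empty : ∀ i → ¬ i ∈ S∖u ∖ ⁅ v ⁆
      empty i i∈ with ∈-∖⁻ S∖u ⁅ v ⁆ i∈
      ... | i∈S∖u , i∉v with ∈-∖⁻ S ⁅ u ⁆ i∈S∖u
      ...   | i∈S , i∉u with only i i∈S
      ...     | inj₁ refl = ∉⇒¬∈ ⁅ u ⁆ {u} i∉u (∈⁅⁆ u)
      ...     | inj₂ refl = ∉⇒¬∈ ⁅ v ⁆ {v} i∉v (∈⁅⁆ v)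

    -- The induction step: bounds for proper subsets of `S`.

    module Rest (S : VSet n) (smaller : ∀ R → card R < card S → Bound R) where

      -- κ = 0 for connected S; κ = 1 for bridgeless S, where the boundary term disappears.
      Rest : ℕ → VSet n → Set
      Rest κ R = ∃ λ k → HasIndependent R k × weight S R ≤ 7 * k + (1 ∸ κ) * (t * edges R (S ∖ R))

      -- Passing from degrees in `R` to degrees in `S` lowers the weight by at least t per boundary
      -- edge (`w-drop`), which pays for the 2t in the induction hypothesis. The exceptional single
      -- edge is covered by `w-pair`.
      rest-connected : ∀ {κ R} → κ ≤ 1 → Uncut κ S → R ⊆ S → ∃ (_∈ R) → ∃ (_∈ S ∖ R) → Uncut 0 R → Rest κ R
      rest-connected {κ} {R} κ≤1 uncut R⊆S inh outside connected with smaller R (card-< R⊆S outside) inh connected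
      ... | inj₁ E@(edge {u} {v} adj u∈ v∈ only) = 1 , independent-⁅⁆ R u∈ ,
              subst₂ (λ p q → p ≤ 7 * 1 + (1 ∸ κ) * (t * q)) (sym weight≡) (sym (∑∈-Edge E (deg∈ X)))
                (w-pair scale κ (deg∈ X u) (deg∈ X v) κ≤1
                  (subst (_≤ 3) du (deg∈≤3 S u)) (subst (_≤ 3) dv (deg∈≤3 S v))
                  (subst (κ <_) (∑∈-Edge E _) (uncut⇒edges uncut R⊆S inh outside)))
        where
        X = S ∖ R
        du : deg∈ S u ≡ suc (deg∈ X u)
        du = trans (∑∈-⊎ (≐-∖ R⊆S) _) (cong (_+ deg∈ X u) (trans (∑∈-Edge E _)
          (cong₂ _+_ (cong b2n (a-irrefl u)) (cong b2n adj))))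
        dv : deg∈ S v ≡ suc (deg∈ X v)
        dv = trans (∑∈-⊎ (≐-∖ R⊆S) _) (cong (_+ deg∈ X v) (trans (∑∈-Edge E _)
          (cong₂ _+_ (cong b2n (trans (a-sym v u) adj)) (cong b2n (a-irrefl v)))))
        weight≡ : weight S R ≡ w t (suc (deg∈ X u)) + w t (suc (deg∈ X v))
        weight≡ = trans (∑∈-Edge E _) (cong₂ (λ p q → w t p + w t q) du dv)
      ... | inj₂ (k , I , bound) = k , I ,
              arith κ (weight S R) k t (edges R X) κ≤1
                (uncut⇒edges uncut R⊆S inh outside) (≤-trans gain bound)
        where
        X = S ∖ R
        gain : weight S R + t * edges R X ≤ weight R R
        gain = subst (_≤ weight R R)
          (trans (∑∈-+ R _ _) (cong (weight S R +_) (∑∈-*ˡ R t (deg∈ X))))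
          (∑∈-mono {R = R} λ i _ → subst (λ d → w t d + t * deg∈ X i ≤ w t (deg∈ R i)) (sym (dS i))
            (w-drop scale (deg∈ R i) (deg∈ X i) (subst (_≤ 3) (dS i) (deg∈≤3 S i))))
          where
          dS : ∀ i → deg∈ S i ≡ deg∈ R i + deg∈ X i
          dS i = ∑∈-⊎ (≐-∖ R⊆S) _
        arith : ∀ κ W k t e → κ ≤ 1 → κ < e → W + t * e ≤ 7 * k + 2 * t →
                W ≤ 7 * k + (1 ∸ κ) * (t * e)
        arith κ W k t e κ≤1 κ<e h = +-cancelʳ-≤ (t * e) W (7 * k + (1 ∸ κ) * (t * e)) (≤-trans h (≤-trans
          (+-monoʳ-≤ (7 * k) (≤-trans (≤-reflexive (*-comm 2 t)) (*-monoʳ-≤ t (two κ e κ≤1 κ<e))))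
          (≤-reflexive (rearrange k (1 ∸ κ) t e))))
          where
          -- If κ = 1, the e ≥ 2 boundary edges already pay for 2t. If κ = 0, there may be just one,
          -- and a second copy of t e is needed: it is the boundary term of `Rest`.
          two : ∀ κ e → κ ≤ 1 → κ < e → 2 ≤ e + (1 ∸ κ) * e
          two 0 (suc e) _ _ = s≤s (≤-trans (s≤s z≤n) (≤-reflexive (sym (+-suc e _))))
          two 1 e _ h = ≤-trans h (m≤m+n e _)
          two (suc (suc κ)) e (s≤s ()) h
          rearrange : ∀ k l t e → 7 * k + t * (e + l * e) ≡ 7 * k + l * (t * e) + t * e
          rearrange = solve-∀

      rest-empty : ∀ {κ} {R} → (∀ i → ¬ i ∈ R) → Rest κ R
      rest-empty {R = R} empty = 0 ,
        independent ∅ (λ _ ()) (λ _ _ ()) (∑∈-∅ {R = ∅} (λ _ ()) (λ _ → 1)) ,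
        ≤-trans (≤-reflexive (∑∈-∅ {R = R} empty _)) z≤n
        where
        ∅ : VSet n
        ∅ _ = false

      -- Without edges between the two parts, their independent sets unite and their boundary edges
      -- add up. The weights add up because degrees are taken in `S` throughout.
      rest-split : ∀ {κ R D} → D ⊆ R → R ⊆ S → edges D (R ∖ D) ≡ 0 → Rest κ D → Rest κ (R ∖ D) → Rest κ R
      rest-split {κ} {R} {D} D⊆R R⊆S none (k , I , b) (l , J , c) = k + l ,
        independent-∪ D⊆R (∖⊆ R D) (≐⇒disjoint {R = R} R≐) (edges≡0⇒nonadjacent D D′ none) I J ,
        ≤-trans (≤-reflexive (∑∈-⊎ R≐ _)) (≤-trans (+-mono-≤ b c) (≤-reflexive (trans
          (rearrange k l (1 ∸ κ) t (edges D (S ∖ D)) (edges D′ (S ∖ D′)))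
          (cong (λ e → 7 * (k + l) + (1 ∸ κ) * (t * e)) (sym edges≡)))))
        where
        D′ = R ∖ D
        R≐ : R ≐ D ⊎ D′
        R≐ = ≐-∖ D⊆R
        edges≡ : edges R (S ∖ R) ≡ edges D (S ∖ D) + edges D′ (S ∖ D′)
        edges≡ = trans (edges-+ˡ R≐ (S ∖ R)) (cong₂ _+_
          (sym (trans (edges-+ʳ (∖-∖ D⊆R R⊆S) D) (cong (_+ edges D (S ∖ R)) none)))
          (sym (trans (edges-+ʳ (∖-∖-∖ D⊆R R⊆S) D′) (cong (_+ edges D′ (S ∖ R)) (trans (edges-sym D′ D) none)))))
        rearrange : ∀ k l m t p q → 7 * k + m * (t * p) + (7 * l + m * (t * q)) ≡ 7 * (k + l) + m * (t * (p + q))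
        rearrange = solve-∀

      -- Components are not formed explicitly: `R` is split along cuts without edges until the
      -- pieces are connected. The number `m` bounds the size of the current piece.
      rest : ∀ {κ} → κ ≤ 1 → Uncut κ S → ∀ R → R ⊆ S → ∃ (_∈ S ∖ R) → Rest κ R
      rest {κ} κ≤1 uncut R = go (card R) R ≤-refl
        where
        go : ∀ m R → card R ≤ m → R ⊆ S → ∃ (_∈ S ∖ R) → Rest κ R
        go m R |R|≤m R⊆S outside with inhabited? R
        ... | no empty = rest-empty {κ} λ i i∈ → empty (i , i∈)
        ... | yes inh@(i , i∈R) with cut? 0 R
        ...   | inj₂ connected = rest-connected κ≤1 uncut R⊆S inh outside connected
        ...   | inj₁ (D , cut D⊆R (j , j∈D) outer few) with m
        ...     | zero = contradiction (≤-trans (∑∈-bound R i∈R (λ _ → 1)) |R|≤m) λ ()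
        ...     | suc m = rest-split {κ} D⊆R R⊆S (n≤0⇒n≡0 few)
          (recurse D D⊆R outer)
          (recurse (R ∖ D) (∖⊆ R D) (j , ∈-∖⁺ R (R ∖ D) (D⊆R j j∈D) (∈⇒∉∖ R D j∈D)))
          where
          recurse : ∀ E → E ⊆ R → ∃ (_∈ R ∖ E) → Rest κ E
          recurse E E⊆R prop = go m E (≤-pred (≤-trans (card-< E⊆R prop) |R|≤m))
            (λ i i∈ → R⊆S i (E⊆R i i∈))
            (proj₁ outside , ≐⇒⊆ʳ {R = S ∖ E} {R ∖ E} {S ∖ R} (∖-∖ E⊆R R⊆S) _ (proj₂ outside))

      -- The induction step: sets with a bridge.

      -- A side A of a bridge of S whose endpoint in A is u: an independent set
      -- of A, and one of A avoiding u.
      record Half (A : VSet n) (u : Fin n) : Set where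
        constructor half
        field
          {free} : ℕ
          free-set : HasIndependent A free
          free-bound : weight S A ≤ 7 * free + t
          {avoiding} : ℕ
          avoiding-set : HasIndependent (A ∖ ⁅ u ⁆) avoiding
          avoiding-bound : weight S A ≤ 7 * avoiding + t + 3 ⊎
                           (weight S A ≤ 7 * avoiding + t + 4 × deg∈ S u ≡ 1)

      -- Both sets come from `rest`. The only boundary edge of `A` is the bridge, which costs t. The
      -- boundary of `A ∖ ⁅ u ⁆` consists of its e edges to `u`; adding the weight of `u`, which has
      -- degree e + 1 in `S`, gives the quantity estimated in `w-end`.
      halve : Uncut 0 S → ∀ {A B u} → S ≐ A ⊎ B → ∃ (_∈ B) → u ∈ A →
              edges A B ≡ 1 → deg∈ B u ≡ 1 → edges (A ∖ ⁅ u ⁆) B ≡ 0 → Half A u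
      halve uncut {A} {B} {u} S≐ (b , b∈B) u∈A eAB dBu eA′B =
        build (rest z≤n uncut A A⊆S (b , b∈S∖A)) (rest z≤n uncut A′ A′⊆S (u , u∈S∖A′))
        where
        A′ = A ∖ ⁅ u ⁆
        A⊆S : A ⊆ S
        A⊆S = ≐⇒⊆ˡ {R = S} S≐
        A′⊆S : A′ ⊆ S
        A′⊆S i i∈ = A⊆S i (∖⊆ A ⁅ u ⁆ i i∈)
        b∈S∖A : b ∈ S ∖ A
        b∈S∖A = trans (≐⇒∖ {R = S} {A} {B} S≐ b) b∈B
        u∈S∖A′ : u ∈ S ∖ A′
        u∈S∖A′ = ∈-∖⁺ S A′ (A⊆S u u∈A) (∈⇒∉∖ A ⁅ u ⁆ (∈⁅⁆ u))
        e = deg∈ A′ u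
        dS : deg∈ S u ≡ suc e
        dS = trans (∑∈-⊎ S≐ _) (trans (cong₂ _+_
          (trans (∑∈-remove A u∈A _) (cong (λ x → b2n x + e) (a-irrefl u))) dBu) (+-comm e 1))
        e≡ : edges A′ (S ∖ A′) ≡ e
        e≡ = trans (edges-+ʳ (∖-∖-∖ (⁅⁆⊆ A u∈A) A⊆S) A′) (trans (cong₂ _+_
          (trans (edges-sym A′ ⁅ u ⁆) (edges-⁅⁆ u A′))
          (trans (edges-congʳ (≐⇒∖ {R = S} S≐) A′) eA′B)) (+-identityʳ e))
        build : Rest 0 A → Rest 0 A′ → Half A u
        build (k , I , p) (l , J , q) = half I
          (subst (weight S A ≤_) (trans
            (cong (λ e → 7 * k + 1 * (t * e)) (trans (edges-congʳ (≐⇒∖ {R = S} S≐) A) eAB)) (rearrange₁ k t)) p)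
          J ([ inj₁ ∘ avoiding , (λ (r , z) → inj₂ (avoiding r , trans dS (cong suc z))) ]′
               (w-end scale e (subst (_≤ 3) dS (deg∈≤3 S u))))
          where
          rearrange₁ : ∀ k t → 7 * k + 1 * (t * 1) ≡ 7 * k + t
          rearrange₁ = solve-∀
          rearrange₂ : ∀ w l t e → w + (7 * l + 1 * (t * e)) ≡ w + t * e + 7 * l
          rearrange₂ = solve-∀
          rearrange₃ : ∀ t x l → t + x + 7 * l ≡ 7 * l + t + x
          rearrange₃ = solve-∀
          avoiding : ∀ {x} → w t (suc e) + t * e ≤ t + x → weight S A ≤ 7 * l + t + x
          avoiding {x} h = ≤-trans (≤-reflexive (trans (∑∈-remove A u∈A _) (cong (λ d → w t d + weight S A′) dS)))
            (≤-trans (+-monoʳ-≤ (w t (suc e)) q)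
            (≤-trans (≤-reflexive (trans (cong (λ y → w t (suc e) + (7 * l + 1 * (t * y))) e≡)
              (rearrange₂ (w t (suc e)) l t e)))
            (≤-trans (+-monoˡ-≤ (7 * l) h) (≤-reflexive (rearrange₃ t x l)))))

      bridge : Uncut 0 S → ∀ {A} → Cut 1 S A →
        Edge S ⊎ ∃ λ k → HasIndependent S k × weight S S ≤ 7 * k + 2 * t
      bridge uncut {A} (cut A⊆S A-inh B-inh few) = conclude
        (halve uncut S≐ B-inh u∈A eAB≡1 dBu eA′B) (halve uncut S≐′ A-inh v∈B eBA≡1 dAv eB′A)
        where
        B = S ∖ A
        S≐ : S ≐ A ⊎ B
        S≐ = ≐-∖ A⊆S
        S≐′ : S ≐ B ⊎ A
        S≐′ = ≐-comm {R = S} {A} {B} S≐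
        B⊆S : B ⊆ S
        B⊆S = ∖⊆ S A
        eAB≡1 : edges A B ≡ 1
        eAB≡1 = ≤-antisym few (uncut⇒edges uncut A⊆S A-inh B-inh)
        eBA≡1 : edges B A ≡ 1
        eBA≡1 = trans (edges-sym B A) eAB≡1
        endA = ∑∈≡1 A (deg∈ B) eAB≡1
        endB = ∑∈≡1 B (deg∈ A) eBA≡1
        u = proj₁ endA
        v = proj₁ endB
        u∈A : u ∈ A
        u∈A = proj₁ (proj₂ endA)
        v∈B : v ∈ B
        v∈B = proj₁ (proj₂ endB)
        dBu = proj₁ (proj₂ (proj₂ endA))
        dAv = proj₁ (proj₂ (proj₂ endB))
        A′ = A ∖ ⁅ u ⁆
        B′ = B ∖ ⁅ v ⁆
        eA′B : edges A′ B ≡ 0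
        eA′B = proj₂ (proj₂ (proj₂ endA))
        eB′A : edges B′ A ≡ 0
        eB′A = proj₂ (proj₂ (proj₂ endB))
        disjoint : ∀ i → i ∈ A → i ∈ B → ⊥
        disjoint = ≐⇒disjoint {R = S} S≐
        -- `u` has a neighbour in `B`, and it must be `v`, since the other vertices of `B` have no
        -- neighbour in `A`.
        uv : a u v ≡ true
        uv with ∑∈-positive B (λ j → b2n (a u j)) (≤-reflexive (sym dBu))
        ... | j , j∈B , pos with j ≟F v
        ...   | yes refl = b2n>0 pos
          where
          b2n>0 : ∀ {b} → 0 < b2n b → b ≡ true
          b2n>0 {true} _ = refl
        ...   | no j≢v = contradiction (subst (λ b → 0 < b2n b) (trans (a-sym u j)
                  (edges≡0⇒nonadjacent B′ A eB′A j u
                    (∈-∖⁺ B ⁅ v ⁆ j∈B (¬∈⇒∉ ⁅ v ⁆ {j} (j≢v ∘ ∈⁅⁆⇒≡ v j))) u∈A)) pos) λ ()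
        -- If there were a further vertex, u and v would form a side without outgoing edges, each
        -- being the only neighbour of the other, and `S` would be disconnected.
        pendant-edge : deg∈ S u ≡ 1 → deg∈ S v ≡ 1 → Edge S
        pendant-edge du dv with inhabited? (S ∖ (⁅ u ⁆ ∪ ⁅ v ⁆))
        ... | no empty = edge uv (A⊆S u u∈A) (B⊆S v v∈B) λ i i∈S →
                only i (λ i∉ → empty (i , ∈-∖⁺ S D i∈S i∉))
          where
          D = ⁅ u ⁆ ∪ ⁅ v ⁆
          only : ∀ i → (i ∉ D → ⊥) → i ≡ u ⊎ i ≡ v
          only i h with i ≟F u | i ≟F v
          ... | yes p | _ = inj₁ p
          ... | no _ | yes q = inj₂ q
          ... | no _ | no _ = ⊥-elim (h refl)
        ... | yes outside = contradiction
                (cut D⊆S (u , trans (cong (_∨ ⁅ v ⁆ u) (∈⁅⁆ u)) refl) outside (≤-reflexive eD))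
                (uncut D)
          where
          D = ⁅ u ⁆ ∪ ⁅ v ⁆
          u≢v : ∀ i → i ∈ ⁅ u ⁆ → i ∈ ⁅ v ⁆ → ⊥
          u≢v i i∈u i∈v with refl ← ∈⁅⁆⇒≡ u i i∈u = disjoint i u∈A (subst (_∈ B) (sym (∈⁅⁆⇒≡ v i i∈v)) v∈B)
          D≐ : D ≐ ⁅ u ⁆ ⊎ ⁅ v ⁆
          D≐ = ≐-∪ ⁅ u ⁆ ⁅ v ⁆ u≢v
          D⊆S : D ⊆ S
          D⊆S i i∈ = [ ⁅⁆⊆ S (A⊆S u u∈A) i , ⁅⁆⊆ S (B⊆S v v∈B) i ]′ (∈-∪⁻ ⁅ u ⁆ ⁅ v ⁆ {i} i∈)
          none : ∀ x y → a x y ≡ true → y ∈ D → deg∈ S x ≡ 1 → deg∈ (S ∖ D) x ≡ 0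
          none x y xy y∈D dx = n≤0⇒n≡0 (+-cancelˡ-≤ 1 _ _ (≤-trans (+-monoˡ-≤ (deg∈ (S ∖ D) x)
            (≤-trans (≤-reflexive (sym (cong b2n xy))) (∑∈-bound D y∈D (λ j → b2n (a x j)))))
            (≤-reflexive (trans (sym (∑∈-⊎ (≐-∖ D⊆S) _)) dx))))
          eD : edges D (S ∖ D) ≡ 0
          eD = trans (edges-+ˡ D≐ (S ∖ D)) (cong₂ _+_
            (trans (edges-⁅⁆ u _) (none u v uv (trans (cong (⁅ u ⁆ v ∨_) (∈⁅⁆ v)) (Bool.∨-zeroʳ _)) du))
            (trans (edges-⁅⁆ v _) (none v u (trans (a-sym v u) uv) (cong (_∨ ⁅ v ⁆ u) (∈⁅⁆ u)) dv)))
        conclude : Half A u → Half B v → Edge S ⊎ ∃ λ k → HasIndependent S k × weight S S ≤ 7 * k + 2 * t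
        conclude (half {k} I p {k′} I′ p′) (half {l} J q {l′} J′ q′) = choose (l ≤? l′) p′ q′
          where
          weight≡ : weight S S ≡ weight S A + weight S B
          weight≡ = ∑∈-⊎ S≐ _
          sum-bound : ∀ {x y z} → weight S A ≤ x → weight S B ≤ y → x + y ≤ z → weight S S ≤ z
          sum-bound f g h = ≤-trans (≤-reflexive weight≡) (≤-trans (+-mono-≤ f g) h)
          without-v : HasIndependent S (k + l′)
          without-v = independent-∪ A⊆S (λ i i∈ → B⊆S i (∖⊆ B ⁅ v ⁆ i i∈))
            (λ i i∈A i∈B′ → disjoint i i∈A (∖⊆ B ⁅ v ⁆ i i∈B′))
            (λ i j i∈ j∈ → trans (a-sym i j) (edges≡0⇒nonadjacent B′ A eB′A j i j∈ i∈)) I J′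
          without-u : HasIndependent S (k′ + l)
          without-u = independent-∪ (λ i i∈ → A⊆S i (∖⊆ A ⁅ u ⁆ i i∈)) B⊆S
            (λ i i∈A′ i∈B → disjoint i (∖⊆ A ⁅ u ⁆ i i∈A′) i∈B)
            (edges≡0⇒nonadjacent A′ B eA′B) I′ J
          -- Here l ≥ l′ + 1, so the independent set has at least k′ + l′ + 1 elements. The
          -- additional 7 absorbs the excess x + y of the two avoiding bounds.
          wide : ∀ {x y} → weight S A ≤ 7 * k′ + t + x → weight S B ≤ 7 * l′ + t + y → x + y ≤ 7 →
                 ¬ l ≤ l′ → weight S S ≤ 7 * (k′ + l) + 2 * t
          wide {x} {y} f g x+y≤7 l≰l′ = sum-bound f g (≤-trans (≤-reflexive (rearrange k′ l′ t x y))
            (≤-trans (+-monoʳ-≤ (7 * (k′ + l′) + 2 * t) x+y≤7) (≤-trans (≤-reflexive (rearrange′ k′ l′ t))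
            (+-monoˡ-≤ (2 * t) (*-monoʳ-≤ 7 (+-monoʳ-≤ k′ (≰⇒> l≰l′)))))))
            where
            rearrange : ∀ k l t x y → 7 * k + t + x + (7 * l + t + y) ≡ 7 * (k + l) + 2 * t + (x + y)
            rearrange = solve-∀
            rearrange′ : ∀ k l t → 7 * (k + l) + 2 * t + 7 ≡ 7 * (k + suc l) + 2 * t
            rearrange′ = solve-∀
          choose : Dec (l ≤ l′) → _ → _ → _
          -- Avoiding `v` costs nothing on the side `B`, so the two free bounds, each with a single
          -- t, suffice.
          choose (yes l≤l′) _ _ = inj₂ (k + l′ , without-v , sum-bound p q
            (≤-trans (≤-reflexive (rearrange k l t)) (+-monoˡ-≤ (2 * t) (*-monoʳ-≤ 7 (+-monoʳ-≤ k l≤l′)))))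
            where
            rearrange : ∀ k l t → 7 * k + t + (7 * l + t) ≡ 7 * (k + l) + 2 * t
            rearrange = solve-∀
          choose (no l≰l′) (inj₁ f) (inj₁ g) = inj₂ (k′ + l , without-u , wide f g (evident 6 7) l≰l′)
          choose (no l≰l′) (inj₁ f) (inj₂ (g , _)) = inj₂ (k′ + l , without-u , wide f g (evident 7 7) l≰l′)
          choose (no l≰l′) (inj₂ (f , _)) (inj₁ g) = inj₂ (k′ + l , without-u , wide f g (evident 7 7) l≰l′)
          -- The excess would be 4 + 4 > 7, but then both ends of the bridge are leaves of `S`.
          choose (no l≰l′) (inj₂ (_ , du)) (inj₂ (_ , dv)) = inj₁ (pendant-edge du dv)

      -- Let d be the minimum degree, attained at `v`. No neighbour outweighs `v`, so its closed
      -- neighbourhood `C` has weight at most (d + 1) w d ≤ 7 + 2t. This is paid for by putting `v`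
      -- into the independent set, and `rest` with κ = 1 bounds the remainder by 7 k with no
      -- boundary term.
      bridgeless : ∃ (_∈ S) → Uncut 1 S → ∃ λ k → HasIndependent S k × weight S S ≤ 7 * k + 2 * t
      bridgeless inh uncut with v , v∈S , min ← argmin {S = S} (deg∈ S) inh =
        1 + k , independent-∪ (⁅⁆⊆ S v∈S) (∖⊆ S C) disjoint no-edge
          (independent-⁅⁆ ⁅ v ⁆ {v} (∈⁅⁆ v)) (proj₁ (proj₂ others)) ,
        ≤-trans (≤-reflexive (∑∈-⊎ S≐ _)) 
          (≤-trans (+-mono-≤ weightC (proj₂ (proj₂ others))) (≤-reflexive (rearrange t k)))
        where
        N C : VSet n
        N i = S i ∧ a v i
        C = ⁅ v ⁆ ∪ N
        d = deg∈ S v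
        C⊆S : C ⊆ S
        C⊆S i i∈ = [ ⁅⁆⊆ S v∈S i , ∧⇒ˡ (S i) ]′ (∈-∪⁻ ⁅ v ⁆ N {i} i∈)
          where
          ∧⇒ˡ : ∀ b {c} → b ∧ c ≡ true → b ≡ true
          ∧⇒ˡ true _ = refl
        S≐ : S ≐ C ⊎ S ∖ C
        S≐ = ≐-∖ C⊆S
        others : Rest 1 (S ∖ C)
        others = rest (evident 1 1) uncut (S ∖ C) (∖⊆ S C)
          (v , ∈-∖⁺ S (S ∖ C) v∈S (∈⇒∉∖ S C (cong (_∨ N v) (∈⁅⁆ v))))
        k = proj₁ others
        disjoint : ∀ i → i ∈ ⁅ v ⁆ → i ∈ S ∖ C → ⊥
        disjoint i i∈v i∈ = ∉⇒¬∈ C {i} (proj₂ (∈-∖⁻ S C i∈)) (cong (_∨ N i) i∈v)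
        no-edge : ∀ i j → i ∈ ⁅ v ⁆ → j ∈ S ∖ C → a i j ≡ false
        no-edge i j i∈v j∈ with refl ← ∈⁅⁆⇒≡ v i i∈v | j∈S , j∉C ← ∈-∖⁻ S C {j} j∈ =
          lemma (⁅ v ⁆ j) (S j) (a v j) j∈S j∉C
          where
          lemma : ∀ x y z → y ≡ true → x ∨ y ∧ z ≡ false → z ≡ false
          lemma false true false _ _ = refl
        C≐ : C ≐ ⁅ v ⁆ ⊎ N
        C≐ = ≐-∪ ⁅ v ⁆ N λ i i∈v i∈N → loop i (∈⁅⁆⇒≡ v i i∈v) i∈N
          where
          loop : ∀ i → i ≡ v → i ∈ N → ⊥
          loop i refl i∈N with () ← trans (sym i∈N) (trans (cong (S i ∧_) (a-irrefl v)) (Bool.∧-zeroʳ (S i)))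
        d≢1 : d ≢ 1
        -- The only edge at a vertex of degree 1 would be a bridge.
        d≢1 d≡1 with j , j∈S , vj ← ∑∈-positive S (λ j → b2n (a v j)) (≤-reflexive (sym d≡1)) =
          uncut ⁅ v ⁆ (cut (⁅⁆⊆ S v∈S) (v , ∈⁅⁆ {n} v)
            (j , ∈-∖⁺ S ⁅ v ⁆ j∈S (¬∈⇒∉ ⁅ v ⁆ {j} λ j∈v → j≢v vj (∈⁅⁆⇒≡ v j j∈v)))
            (≤-trans (≤-reflexive (edges-⁅⁆ v _)) (≤-trans (∑∈-⊆ (∖⊆ S ⁅ v ⁆) _) (≤-reflexive d≡1))))
          where
          j≢v : ∀ {j} → 0 < b2n (a v j) → j ≢ v
          j≢v pos refl with () ← subst (λ b → 0 < b2n b) (a-irrefl v) pos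
        weightN : weight S N ≤ d * w t d
        weightN = ≤-trans
          (∑∈-mono {R = N} λ i i∈ → w-antitone
            (min i (C⊆S i (trans (cong (⁅ v ⁆ i ∨_) i∈) (Bool.∨-zeroʳ _))))
            (deg∈≤3 S i))
          (≤-reflexive (trans (sum-cong-≗ λ i → term (S i) (a v i))
            (sym (*-distribʳ-sum (w t d) (λ i → if S i then b2n (a v i) else 0)))))
          where
          w-antitone : ∀ {x y} → x ≤ y → y ≤ 3 → w t y ≤ w t x
          w-antitone {x} {y} x≤y y≤3 = ≤-trans (m≤m+n (w t y) (t * (y ∸ x)))
            (subst (λ z → w t z + t * (y ∸ x) ≤ w t x) (m+[n∸m]≡n x≤y)
            (w-drop scale x (y ∸ x) (subst (_≤ 3) (sym (m+[n∸m]≡n x≤y)) y≤3)))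
          term : ∀ b c {x} → (if b ∧ c then x else 0) ≡ (if b then b2n c else 0) * x
          term true true = sym (*-identityˡ _)
          term true false = refl
          term false c = refl
        weightC : weight S C ≤ 7 + 2 * t
        weightC = ≤-trans (≤-reflexive (trans (∑∈-⊎ C≐ _) (cong (_+ weight S N) (∑∈-⁅⁆ v _))))
          (≤-trans (+-monoʳ-≤ (w t d) weightN) (w-star scale d (deg∈≤3 S v) d≢1))
        rearrange : ∀ t k → 7 + 2 * t + (7 * k + 0) ≡ 7 * (1 + k) + 2 * t
        rearrange = solve-∀

    bounded : ∀ S → Bound S
    bounded S = go (suc (card S)) S ≤-refl
      where
      go : ∀ m S → card S < m → Bound S
      go (suc m) S (s≤s |S|≤m) inh uncut with cut? 1 S
      ... | inj₁ (A , c) = Rest.bridge S (λ R R<S → go m R (≤-trans R<S |S|≤m)) uncut c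
      ... | inj₂ uncut₁ = inj₂ (Rest.bridgeless S (λ R R<S → go m R (≤-trans R<S |S|≤m)) inh uncut₁)

  -- Degree counts, independence numbers and isomorphisms.

  listSum : ∀ {n} (f : Fin n → ℕ) → ℕList.sum (List.map f (List.allFin n)) ≡ sum f
  listSum f = trans (cong ℕList.sum (map-tabulate id f)) (go f)
    where
    go : ∀ {n} (f : Fin n → ℕ) → ℕList.sum (List.tabulate f) ≡ sum f
    go {zero} f = refl
    go {suc n} f = cong (f zero +_) (go (f ∘ suc))

  deg≡ : ∀ G v → deg G v ≡ sum (λ u → b2n (adj G v u))
  deg≡ G v = listSum (λ u → b2n (adj G v u))

  numDeg≡ : ∀ G i → numDeg G i ≡ sum (λ v → b2n ⌊ deg G v ≟ i ⌋)
  numDeg≡ G i = listSum (λ v → b2n ⌊ deg G v ≟ i ⌋)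

  ∑deg : Graph → (ℕ → ℕ) → ℕ
  ∑deg G f = sum (λ v → f (deg G v))

  -- `IsAlpha` for Boolean predicates, which can be pulled back along vertex maps by composition.
  record Alpha (G : Graph) (k : ℕ) : Set where
    field
      set : VSet (n G)
      nonadjacent : ∀ i j → i ∈ set → j ∈ set → adj G i j ≡ false
      card≡ : card set ≡ k
      maximum : ∀ I → (∀ i j → i ∈ I → j ∈ I → adj G i j ≡ false) → card I ≤ k

  card-lookup : ∀ {n} (s : Subset n) → ∣ s ∣ ≡ card (lookup s)
  card-lookup [] = refl
  card-lookup (true ∷ s) = cong suc (card-lookup s)
  card-lookup (false ∷ s) = card-lookup s

  IsAlpha⇒Alpha : ∀ {G k} → IsAlpha G k → Alpha G k
  IsAlpha⇒Alpha {G} {k} ((S , ind , eq) , max) = record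
    { set = lookup S
    ; nonadjacent = λ i j i∈ j∈ → ind i j (lookup⇒[]= i S i∈) (lookup⇒[]= j S j∈)
    ; card≡ = trans (sym (card-lookup S)) eq
    ; maximum = λ I I-ind → subst (_≤ k) (trans (card-lookup (tabulate I)) (∑∈-congˡ _ (lookup∘tabulate I)))
        (max (tabulate I) λ i j i∈ j∈ → I-ind i j (member I i∈) (member I j∈))
    }
    where
    member : ∀ {n} (I : VSet n) {i} → i Data.Fin.Subset.∈ tabulate I → i ∈ I
    member I {i} i∈ = trans (sym (lookup∘tabulate I i)) ([]=⇒lookup i∈)

  Alpha-unique : ∀ {G k l} → Alpha G k → Alpha G l → k ≡ l
  Alpha-unique α β = ≤-antisym
    (≤-trans (≤-reflexive (sym (α .card≡))) (β .maximum _ (α .nonadjacent)))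
    (≤-trans (≤-reflexive (sym (β .card≡))) (α .maximum _ (β .nonadjacent)))
    where open Alpha

  weighted-count : ∀ G (f : ℕ → ℕ) →
    sum (λ v → f 1 * b2n ⌊ deg G v ≟ 1 ⌋ + f 2 * b2n ⌊ deg G v ≟ 2 ⌋ + f 3 * b2n ⌊ deg G v ≟ 3 ⌋)
      ≡ f 1 * numDeg G 1 + f 2 * numDeg G 2 + f 3 * numDeg G 3
  weighted-count G f = trans (∑-distrib-+ _ (term 3))
    (cong₂ _+_ (trans (∑-distrib-+ (term 1) (term 2)) (cong₂ _+_ (pull 1) (pull 2))) (pull 3))
    where
    term : ℕ → Fin (n G) → ℕ
    term i v = f i * b2n ⌊ deg G v ≟ i ⌋
    pull : ∀ i → sum (term i) ≡ f i * numDeg G i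
    pull i = trans (sym (*-distribˡ-sum (f i) (λ v → b2n ⌊ deg G v ≟ i ⌋))) (cong (f i *_) (sym (numDeg≡ G i)))

  -- A vertex of degree 1, 2 or 3 contributes the same to both sides; any other contributes 0 on the
  -- left.
  numDeg-≤ : ∀ G f → f 1 * numDeg G 1 + f 2 * numDeg G 2 + f 3 * numDeg G 3 ≤ ∑deg G f
  numDeg-≤ G f = ≤-trans (≤-reflexive (sym (weighted-count G f))) (sum-mono λ v → go (deg G v))
    where
    go : ∀ d → f 1 * b2n ⌊ d ≟ 1 ⌋ + f 2 * b2n ⌊ d ≟ 2 ⌋ + f 3 * b2n ⌊ d ≟ 3 ⌋ ≤ f d
    go 0 rewrite *-zeroʳ (f 1) | *-zeroʳ (f 2) | *-zeroʳ (f 3) = z≤n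
    go 1 rewrite *-identityʳ (f 1) | *-zeroʳ (f 2) | *-zeroʳ (f 3) = ≤-reflexive (trans (+-identityʳ _) (+-identityʳ _))
    go 2 rewrite *-zeroʳ (f 1) | *-identityʳ (f 2) | *-zeroʳ (f 3) = ≤-reflexive (+-identityʳ _)
    go 3 rewrite *-zeroʳ (f 1) | *-zeroʳ (f 2) | *-identityʳ (f 3) = ≤-refl
    go (suc (suc (suc (suc d)))) rewrite *-zeroʳ (f 1) | *-zeroʳ (f 2) | *-zeroʳ (f 3) = z≤n

  numDeg-≡ : ∀ G f → (∀ v → 1 ≤ deg G v × deg G v ≤ 3) →
             f 1 * numDeg G 1 + f 2 * numDeg G 2 + f 3 * numDeg G 3 ≡ ∑deg G f
  numDeg-≡ G f h = trans (sym (weighted-count G f)) (sum-cong-≗ λ v → go (deg G v) (h v))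
    where
    go : ∀ d → 1 ≤ d × d ≤ 3 → f 1 * b2n ⌊ d ≟ 1 ⌋ + f 2 * b2n ⌊ d ≟ 2 ⌋ + f 3 * b2n ⌊ d ≟ 3 ⌋ ≡ f d
    go 1 _ rewrite *-identityʳ (f 1) | *-zeroʳ (f 2) | *-zeroʳ (f 3) = trans (+-identityʳ _) (+-identityʳ _)
    go 2 _ rewrite *-zeroʳ (f 1) | *-identityʳ (f 2) | *-zeroʳ (f 3) = +-identityʳ _
    go 3 _ rewrite *-zeroʳ (f 1) | *-zeroʳ (f 2) | *-identityʳ (f 3) = refl
    go (suc (suc (suc (suc d)))) (_ , s≤s (s≤s (s≤s ())))

  sum-bijective : ∀ {m n} {f : Fin m → Fin n} → Bijective _≡_ _≡_ f → ∀ g → sum g ≡ sum (g ∘ f)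
  sum-bijective bij g = sum-permute g (⤖⇒↔ (mk⤖ bij))

  module _ {G H : Graph} (iso : Iso G H) where

    private
      f = proj₁ iso
      bij = proj₁ (proj₂ iso)
      hom = proj₂ (proj₂ iso)

    deg-iso : ∀ v → deg G v ≡ deg H (f v)
    deg-iso v = trans (deg≡ G v) (trans (sum-cong-≗ λ u → cong b2n (hom v u))
      (sym (trans (deg≡ H (f v)) (sum-bijective bij (λ u → b2n (adj H (f v) u))))))

    ∑deg-iso : ∀ h → ∑deg G h ≡ ∑deg H h
    ∑deg-iso h = trans (sum-cong-≗ (cong h ∘ deg-iso)) (sym (sum-bijective bij (λ v → h (deg H v))))

    Alpha-iso : ∀ {k} → Alpha H k → Alpha G k
    Alpha-iso α = record
      { set = set ∘ f
      ; nonadjacent = λ i j i∈ j∈ → trans (hom i j) (nonadjacent (f i) (f j) i∈ j∈)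
      ; card≡ = trans (sym (sum-bijective bij (λ i → if set i then 1 else 0))) card≡
      ; maximum = λ I I-ind → ≤-trans (≤-reflexive (trans
          (sum-cong-≗ λ i → cong (λ j → if I j then 1 else 0) (sym (strictlyInverseʳ i)))
          (sym (sum-bijective bij (λ i → if I (from i) then 1 else 0)))))
          (maximum (I ∘ from) λ i j i∈ j∈ → trans
            (sym (trans (hom (from i) (from j)) (cong₂ (adj H) (strictlyInverseˡ i) (strictlyInverseˡ j))))
            (I-ind (from i) (from j) i∈ j∈))
      }
      where
      open Alpha α
      open Inverse (⤖⇒↔ (mk⤖ bij)) using (from; strictlyInverseˡ; strictlyInverseʳ)

  connected⇒bound : ∀ {G k t} → Scale t → InClassG G → Alpha G k → ∑deg G (w t) ≤ 7 * k + 2 * t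
  connected⇒bound {G} {k} {t} sc (connected , subcubic , _ , s≤s (s≤s (s≤s _))) α =
    [ ⊥-elim ∘ not-edge , conclude ]′ (bounded full (zero , refl) uncut)
    where
    open SubcubicGraph (adj G) (adj-sym G) (adj-irrefl G) (λ v → subst (_≤ 3) (deg≡ G v) (subcubic v)) sc
    full : VSet (n G)
    full _ = true
    -- A side with no outgoing edge is closed under `Reach`, so connectedness would put the outside
    -- vertex `v` into it.
    uncut : Uncut 0 full
    uncut D (cut _ (u , u∈D) (v , v∈) few) = ∉⇒¬∈ D {v} (proj₂ (∈-∖⁻ full D v∈)) (closed (connected u v) u∈D)
      where
      closed : ∀ {u v} → Reach G u v → u ∈ D → v ∈ D
      closed here u∈D = u∈D
      closed {u} (step {w = x} ux r) u∈D with D x in eq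
      ... | true = closed r eq
      ... | false with () ← trans (sym ux)
                              (edges≡0⇒nonadjacent D (full ∖ D) (n≤0⇒n≡0 few) u x u∈D (cong not eq))
    -- Pigeonhole: three distinct vertices cannot all be among the two ends of an edge.
    not-edge : ¬ Edge full
    not-edge E with Edge.only E zero refl | Edge.only E (suc zero) refl | Edge.only E (suc (suc zero)) refl
    ... | inj₁ refl | inj₂ refl | inj₁ ()
    ... | inj₁ refl | inj₂ refl | inj₂ ()
    ... | inj₂ refl | inj₁ refl | inj₁ ()
    ... | inj₂ refl | inj₁ refl | inj₂ ()
    ... | inj₁ refl | inj₁ () | _
    ... | inj₂ refl | inj₂ () | _
    conclude : (∃ λ l → HasIndependent full l × weight full full ≤ 7 * l + 2 * t) → ∑deg G (w t) ≤ 7 * k + 2 * t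
    conclude (l , I , b) = ≤-trans (≤-reflexive (sum-cong-≗ λ v → cong (w t) (deg≡ G v)))
      (≤-trans b (+-monoˡ-≤ (2 * t) (*-monoʳ-≤ 7
        (≤-trans (≤-reflexive (sym (HasIndependent.card≡ I))) (Alpha.maximum α _ (HasIndependent.nonadjacent I))))))

  -- Sums over a vertex set in two blocks, and cliques.

  ⌊⌋≡does : ∀ {A : Set} (d : Dec A) → ⌊ d ⌋ ≡ does d
  ⌊⌋≡does (yes _) = refl
  ⌊⌋≡does (no _) = refl

  sum-↑ : ∀ m {n} (f : Fin (m + n) → ℕ) → sum f ≡ sum (λ a → f (a ↑ˡ n)) + sum (λ b → f (m ↑ʳ b))
  sum-↑ zero f = refl
  sum-↑ (suc m) {n} f = trans (cong (f zero +_) (sum-↑ m (f ∘ suc))) (sym (+-assoc (f zero) _ _))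

  ∀-↑ : ∀ m {n} (P : Fin (m + n) → Set) → (∀ a → P (a ↑ˡ n)) → (∀ b → P (m ↑ʳ b)) → ∀ i → P i
  ∀-↑ zero P l r i = r i
  ∀-↑ (suc m) P l r zero = l zero
  ∀-↑ (suc m) P l r (suc i) = ∀-↑ m (P ∘ suc) (l ∘ suc) r i

  ↑ˡ≢↑ʳ : ∀ {m n} (a : Fin m) (b : Fin n) → a ↑ˡ n ≢ m ↑ʳ b
  ↑ˡ≢↑ʳ zero b ()
  ↑ˡ≢↑ʳ (suc a) b eq = ↑ˡ≢↑ʳ a b (Fin.suc-injective eq)

  sum-does-≟ : ∀ {n} (u : Fin n) → sum (λ i → b2n (does (i ≟F u))) ≡ 1
  sum-does-≟ u = trans (sum-cong-≗ λ i → b2n≡if (does (i ≟F u))) (∑∈-⁅⁆ u (λ _ → 1))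
    where
    b2n≡if : ∀ b → b2n b ≡ (if b then 1 else 0)
    b2n≡if true = refl
    b2n≡if false = refl

  clique-bound : ∀ {n} (I : VSet n) → (∀ i j → i ≢ j → i ∈ I → j ∈ I → ⊥) → card I ≤ 1
  clique-bound {zero} I h = z≤n
  clique-bound {suc n} I h with I zero in eq
  ... | false = clique-bound (I ∘ suc) λ i j i≢j → h (suc i) (suc j) (i≢j ∘ Fin.suc-injective)
  ... | true = s≤s (≤-reflexive (∑∈-∅ {R = I ∘ suc} (λ i i∈ → h zero (suc i) (λ ()) eq i∈) (λ _ → 1)))

  -- Equality for the triangle trees of class 𝒜.

  K₃-alpha : Alpha (K 3) 1
  K₃-alpha = record
    { set = ⁅ zero ⁆
    ; nonadjacent = λ { zero zero _ _ → refl }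
    ; card≡ = refl
    ; maximum = λ I ind → clique-bound I λ i j i≢j i∈ j∈ →
        false≢true (trans (sym (ind i j i∈ j∈)) (adjacent i j i≢j))
    }
    where
    false≢true : false ≢ true
    false≢true ()
    adjacent : ∀ i j → i ≢ j → adj (K 3) i j ≡ true
    adjacent i j i≢j with i ≟F j
    ... | yes i≡j = contradiction i≡j i≢j
    ... | no _ = refl

  module AttachTriangle (G : Graph) (x : Fin (n G)) where
    private
      N = n G
      H = attachTriangle G x

    adj-ll : ∀ a b → adj H (a ↑ˡ 3) (b ↑ˡ 3) ≡ adj G a b
    adj-ll a b with (a ↑ˡ 3) ≟F (b ↑ˡ 3)
    ... | yes eq with refl ← ↑ˡ-injective 3 a b eq = sym (adj-irrefl G a)
    ... | no _ rewrite splitAt-↑ˡ N a 3 | splitAt-↑ˡ N b 3 = trans (cong (adj G a b ∨_) (adj-sym G b a)) (Bool.∨-idem _)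

    adj-lr : ∀ a b → adj H (a ↑ˡ 3) (N ↑ʳ b) ≡ eqᵇ a x ∧ eqᵇ b zero
    adj-lr a b with (a ↑ˡ 3) ≟F (N ↑ʳ b)
    ... | yes eq = contradiction eq (↑ˡ≢↑ʳ a b)
    ... | no _ rewrite splitAt-↑ˡ N a 3 | splitAt-↑ʳ N 3 b = Bool.∨-identityʳ _

    adj-rr : ∀ b c → adj H (N ↑ʳ b) (N ↑ʳ c) ≡ not (eqᵇ b c)
    adj-rr b c with (N ↑ʳ b) ≟F (N ↑ʳ c)
    ... | yes eq with refl ← ↑ʳ-injective N b c eq = cong not (sym (trans (⌊⌋≡does (b ≟F b)) (∈⁅⁆ b)))
    ... | no _ rewrite splitAt-↑ʳ N 3 b | splitAt-↑ʳ N 3 c with b ≟F c | c ≟F b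
    ...   | yes refl | no ¬p = contradiction refl ¬p
    ...   | no ¬p | yes refl = contradiction refl ¬p
    ...   | yes _ | yes _ = refl
    ...   | no _ | no _ = refl

    deg-l : ∀ a → deg H (a ↑ˡ 3) ≡ deg G a + b2n (⁅ x ⁆ a)
    deg-l a = trans (deg≡ H _) (trans (sum-↑ N _) (cong₂ _+_
      (trans (sum-cong-≗ λ b → cong b2n (adj-ll a b)) (sym (deg≡ G a)))
      (trans (sum-cong-≗ λ b → cong b2n (trans (adj-lr a b) (cong (_∧ eqᵇ b zero) (⌊⌋≡does (a ≟F x)))))
        (go (⁅ x ⁆ a)))))
      where
      go : ∀ e → sum {3} (λ b → b2n (e ∧ eqᵇ b zero)) ≡ b2n e
      go true = refl
      go false = refl

    deg-r : ∀ b → deg H (N ↑ʳ b) ≡ b2n (eqᵇ b zero) + 2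
    deg-r b = trans (deg≡ H _) (trans (sum-↑ N _) (cong₂ _+_
      (trans (sum-cong-≗ λ a → cong b2n (trans (adj-sym H _ _)
        (trans (adj-lr a b) (cong (_∧ eqᵇ b zero) (⌊⌋≡does (a ≟F x))))))
        (attached (eqᵇ b zero)))
      (trans (sum-cong-≗ λ c → cong b2n (adj-rr b c)) (others b))))
      where
      attached : ∀ e → sum (λ a → b2n (⁅ x ⁆ a ∧ e)) ≡ b2n e
      attached true = trans (sum-cong-≗ λ a → cong b2n (Bool.∧-identityʳ (⁅ x ⁆ a))) (sum-does-≟ x)
      attached false = sum-zero λ a → cong b2n (Bool.∧-zeroʳ (⁅ x ⁆ a))
      others : ∀ b → sum {3} (λ c → b2n (not (eqᵇ b c))) ≡ 2
      others zero = refl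
      others (suc zero) = refl
      others (suc (suc zero)) = refl

    -- The degree of `x` rises from 2 to 3, and the triangle brings degrees 3, 2, 2. The term `f 2`
    -- lost at `x` stands on the left to avoid subtraction.
    ∑deg-attach : deg G x ≡ 2 → ∀ f → ∑deg H f + f 2 ≡ ∑deg G f + 2 * (f 2 + f 3)
    ∑deg-attach dx f = begin
      ∑deg H f + f 2                                      ≡⟨ cong (_+ f 2) (sum-↑ N _) ⟩
      left + right + f 2                                   ≡⟨ cong (λ y → y + right + f 2) left≡ ⟩
      f 3 + rest + right + f 2                              ≡⟨ cong (λ y → f 3 + rest + y + f 2) right≡ ⟩
      f 3 + rest + (f 3 + (f 2 + (f 2 + 0))) + f 2          ≡⟨ rearrange (f 2) (f 3) rest ⟩
      f 2 + rest + 2 * (f 2 + f 3)                          ≡⟨ cong (_+ 2 * (f 2 + f 3)) ∑G≡ ⟨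
      ∑deg G f + 2 * (f 2 + f 3)                            ∎
      where
      open ≡-Reasoning
      full : VSet N
      full _ = true
      left right rest : ℕ
      left = sum (λ a → f (deg H (a ↑ˡ 3)))
      right = sum (λ b → f (deg H (N ↑ʳ b)))
      rest = ∑∈ (full ∖ ⁅ x ⁆) (λ a → f (deg G a))
      left≡ : left ≡ f 3 + rest
      left≡ = trans (∑∈-remove full {x} refl (λ a → f (deg H (a ↑ˡ 3)))) (cong₂ _+_
        (cong f (trans (deg-l x) (cong₂ (λ d e → d + b2n e) dx (∈⁅⁆ x))))
        (∑∈-cong {R = full ∖ ⁅ x ⁆} λ a a∈ → cong f (trans (deg-l a)
          (trans (cong (λ e → deg G a + b2n e) (proj₂ (∈-∖⁻ full ⁅ x ⁆ {a} a∈))) (+-identityʳ _)))))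
      right≡ : right ≡ f 3 + (f 2 + (f 2 + 0))
      right≡ = sum-cong-≗ (λ b → cong f (deg-r b))
      ∑G≡ : ∑deg G f ≡ f 2 + rest
      ∑G≡ = trans (∑∈-remove full {x} refl (λ a → f (deg G a))) (cong (λ d → f d + rest) dx)
      rearrange : ∀ p q r → q + r + (q + (p + (p + 0))) + p ≡ p + r + 2 * (p + q)
      rearrange = solve-∀

    attach-subcubic : deg G x ≡ 2 → (∀ v → 1 ≤ deg G v × deg G v ≤ 3) → ∀ v → 1 ≤ deg H v × deg H v ≤ 3
    attach-subcubic dx h = ∀-↑ N _ left right
      where
      left : ∀ a → 1 ≤ deg H (a ↑ˡ 3) × deg H (a ↑ˡ 3) ≤ 3
      left a rewrite deg-l a with a ≟F x
      ... | yes refl rewrite dx = s≤s z≤n , ≤-refl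
      ... | no _ rewrite +-identityʳ (deg G a) = h a
      right : ∀ b → 1 ≤ deg H (N ↑ʳ b) × deg H (N ↑ʳ b) ≤ 3
      right b rewrite deg-r b = go (eqᵇ b zero)
        where
        go : ∀ e → 1 ≤ b2n e + 2 × b2n e + 2 ≤ 3
        go true = s≤s z≤n , ≤-refl
        go false = s≤s z≤n , s≤s (s≤s z≤n)

    -- A triangle vertex other than the attached one can be added to any independent set of `G`,
    -- while an independent set meets the triangle at most once.
    attach-alpha : ∀ {k} → Alpha G k → Alpha H (k + 1)
    attach-alpha {k} α = record
      { set = joined
      ; nonadjacent = ∀-↑ N _
          (λ a → ∀-↑ N _
            (λ b a∈ b∈ → trans (adj-ll a b) (nonadjacent a b (joined-l a∈) (joined-l b∈)))
            (λ b a∈ b∈ → trans (adj-lr a b) (trans (cong (eqᵇ a x ∧_) (one≢zero b (joined-r b∈))) (Bool.∧-zeroʳ _))))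
          (λ b → ∀-↑ N _
            (λ a b∈ a∈ → trans (adj-sym H _ _) (trans (adj-lr a b)
              (trans (cong (eqᵇ a x ∧_) (one≢zero b (joined-r b∈))) (Bool.∧-zeroʳ _))))
            (λ c b∈ c∈ → trans (adj-rr b c) (one≡one b c (joined-r b∈) (joined-r c∈))))
      ; card≡ = trans (sum-↑ N _) (cong₂ _+_
          (trans (sum-cong-≗ λ a → cong (λ s → if [ set , ⁅ suc zero ⁆ ]′ s then 1 else 0) (splitAt-↑ˡ N a 3)) card≡)
          (sum-cong-≗ λ b → cong (λ s → if [ set , ⁅ suc zero ⁆ ]′ s then 1 else 0) (splitAt-↑ʳ N 3 b)))
      ; maximum = λ I ind → ≤-trans (≤-reflexive (sum-↑ N _)) (+-mono-≤
          (maximum (λ a → I (a ↑ˡ 3)) λ a b a∈ b∈ → trans (sym (adj-ll a b)) (ind _ _ a∈ b∈))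
          (clique-bound (λ b → I (N ↑ʳ b)) λ b c b≢c b∈ c∈ →
            distinct b c b≢c (trans (sym (adj-rr b c)) (ind _ _ b∈ c∈))))
      }
      where
      open Alpha α
      joined : VSet (N + 3)
      joined i = [ set , ⁅ suc zero ⁆ ]′ (splitAt N i)
      joined-l : ∀ {a} → a ↑ˡ 3 ∈ joined → a ∈ set
      joined-l {a} p rewrite splitAt-↑ˡ N a 3 = p
      joined-r : ∀ {b} → N ↑ʳ b ∈ joined → b ∈ ⁅ suc zero ⁆
      joined-r {b} p rewrite splitAt-↑ʳ N 3 b = p
      one≢zero : ∀ b → b ∈ ⁅ suc {2} zero ⁆ → eqᵇ b zero ≡ false
      one≢zero = λ { (suc b) _ → refl }
      one≡one : ∀ b c → b ∈ ⁅ suc zero ⁆ → c ∈ ⁅ suc zero ⁆ → not (eqᵇ b c) ≡ false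
      one≡one = λ { (suc zero) (suc zero) _ _ → refl }
      distinct : ∀ b c → b ≢ c → not (eqᵇ b c) ≡ false → ⊥
      distinct b c b≢c eq with b ≟F c
      ... | yes b≡c = b≢c b≡c
      distinct b c b≢c () | no _

  -- The invariant of the recursion defining 𝒜. The equality is the one for t = 1, which belongs to
  -- c₁ = 5/7.
  record TriangleTree (G : Graph) : Set where
    field
      {k} : ℕ
      alpha : Alpha G k
      degrees : ∀ v → 1 ≤ deg G v × deg G v ≤ 3
      total : ∑deg G (w 1) ≡ 7 * k + 2

  TriangleTree-iso : ∀ {G H} → Iso G H → TriangleTree H → TriangleTree G
  TriangleTree-iso {G} {H} iso tree = record
    { alpha = Alpha-iso iso alpha
    ; degrees = λ v → subst (λ d → 1 ≤ d × d ≤ 3) (sym (deg-iso {G} {H} iso v)) (degrees _)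
    ; total = trans (∑deg-iso {G} {H} iso (w 1)) total
    }
    where open TriangleTree tree

  InA⇒TriangleTree : ∀ {G} → InA G → TriangleTree G
  InA⇒TriangleTree (base iso) = TriangleTree-iso iso record
    { alpha = K₃-alpha
    ; degrees = λ { zero → degree ; (suc zero) → degree ; (suc (suc zero)) → degree }
    ; total = refl
    }
    where
    degree : 1 ≤ 2 × 2 ≤ 3
    degree = s≤s z≤n , s≤s (s≤s z≤n)
  InA⇒TriangleTree (grow {G' = G} inA x dx iso) = TriangleTree-iso iso record
    { alpha = attach-alpha alpha
    ; degrees = attach-subcubic dx degrees
    -- For t = 1 the weights of degrees 2 and 3 are 3 and 2, so the total grows by 2 (3 + 2) - 3 =
    -- 7, matching the growth of α by one.
    ; total = +-cancelʳ-≡ 3 _ _ (trans (∑deg-attach dx (w 1)) (trans (cong (_+ 10) total) (rearrange k)))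
    }
    where
    open AttachTriangle G x
    open TriangleTree (InA⇒TriangleTree inA)
    rearrange : ∀ k → 7 * k + 2 + 10 ≡ 7 * (k + 1) + 2 + 3
    rearrange = solve-∀

  -- Equality for the combs of class ℬ.

  module Comb (m : ℕ) where
    private
      H = comb m

    -- The form with `does` is chosen because `does (x ≟ y)` computes to `x ≡ᵇ y`, on which the sums
    -- below recurse.
    adj-ll : ∀ a b → adj H (a ↑ˡ m) (b ↑ˡ m) ≡ does (suc (toℕ a) ≟ toℕ b) ∨ does (suc (toℕ b) ≟ toℕ a)
    adj-ll a b with (a ↑ˡ m) ≟F (b ↑ˡ m)
    ... | yes eq with refl ← ↑ˡ-injective m a b eq =
      sym (trans (Bool.∨-idem _) (irrefl (suc (toℕ a) ≟ toℕ a)))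
      where
      irrefl : (d : Dec (suc (toℕ a) ≡ toℕ a)) → does d ≡ false
      irrefl (yes q) = contradiction q 1+n≢n
      irrefl (no _) = refl
    ... | no _ rewrite splitAt-↑ˡ m a m | splitAt-↑ˡ m b m =
      cong₂ _∨_ (⌊⌋≡does (suc (toℕ a) ≟ toℕ b)) (⌊⌋≡does (suc (toℕ b) ≟ toℕ a))

    adj-lr : ∀ a b → adj H (a ↑ˡ m) (m ↑ʳ b) ≡ does (b ≟F a)
    adj-lr a b with (a ↑ˡ m) ≟F (m ↑ʳ b)
    ... | yes eq = contradiction eq (↑ˡ≢↑ʳ a b)
    ... | no _ rewrite splitAt-↑ˡ m a m | splitAt-↑ʳ m m b = trans (Bool.∨-identityʳ _) (swap (a ≟F b) (b ≟F a))
      where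
      swap : (d : Dec (a ≡ b)) (e : Dec (b ≡ a)) → ⌊ d ⌋ ≡ does e
      swap (yes _) (yes _) = refl
      swap (no _) (no _) = refl
      swap (yes q) (no ¬q) = contradiction (sym q) ¬q
      swap (no ¬q) (yes q) = contradiction (sym q) ¬q

    adj-rr : ∀ a b → adj H (m ↑ʳ a) (m ↑ʳ b) ≡ false
    adj-rr a b with (m ↑ʳ a) ≟F (m ↑ʳ b)
    ... | yes _ = refl
    ... | no _ rewrite splitAt-↑ʳ m m a | splitAt-↑ʳ m m b = refl

    sum-≡ᵇ : ∀ n x → sum {n} (λ b → b2n (x ≡ᵇ toℕ b)) ≡ b2n (x <ᵇ n)
    sum-≡ᵇ zero zero = refl
    sum-≡ᵇ zero (suc x) = refl
    sum-≡ᵇ (suc n) zero = cong suc (sum-zero {n} {λ _ → 0} λ _ → refl)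
    sum-≡ᵇ (suc n) (suc x) = sum-≡ᵇ n x

    sum-suc-≡ᵇ : ∀ {n} (a : Fin n) → sum {n} (λ b → b2n (suc (toℕ b) ≡ᵇ toℕ a)) ≡ b2n (0 <ᵇ toℕ a)
    sum-suc-≡ᵇ {n} zero = sum-zero {n} {λ _ → 0} λ _ → refl
    sum-suc-≡ᵇ {n} (suc a) = trans (sum-cong-≗ {n} λ b → cong b2n (≡ᵇ-comm (toℕ b) (toℕ a)))
      (trans (sum-≡ᵇ n (toℕ a)) (lemma (toℕ<n a)))
      where
      ≡ᵇ-comm : ∀ x y → (x ≡ᵇ y) ≡ (y ≡ᵇ x)
      ≡ᵇ-comm zero zero = refl
      ≡ᵇ-comm zero (suc y) = refl
      ≡ᵇ-comm (suc x) zero = refl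
      ≡ᵇ-comm (suc x) (suc y) = ≡ᵇ-comm x y
      lemma : ∀ {x y} → x < y → b2n (x <ᵇ suc y) ≡ 1
      lemma {zero} _ = refl
      lemma {suc x} {suc y} (s≤s h) = lemma h

    -- The summands stand for the next path vertex, the previous one and the pendant vertex.
    path-degree : ℕ → ℕ
    path-degree a = b2n (suc a <ᵇ m) + b2n (0 <ᵇ a) + 1

    deg-l : ∀ a → deg H (a ↑ˡ m) ≡ path-degree (toℕ a)
    deg-l a = trans (deg≡ H _) (trans (sum-↑ m _) (cong₂ _+_
      (trans (sum-cong-≗ λ b → trans (cong b2n (adj-ll a b)) (one-side (toℕ a) (toℕ b)))
        (trans (∑-distrib-+ {m} (λ b → b2n (suc (toℕ a) ≡ᵇ toℕ b)) (λ b → b2n (suc (toℕ b) ≡ᵇ toℕ a)))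
          (cong₂ _+_ (sum-≡ᵇ m (suc (toℕ a))) (sum-suc-≡ᵇ a))))
      (trans (sum-cong-≗ λ b → cong b2n (adj-lr a b)) (sum-does-≟ a))))
      where
      -- A vertex cannot both follow and precede another, so the disjunction counts as a sum.
      one-side : ∀ x y → b2n ((suc x ≡ᵇ y) ∨ (suc y ≡ᵇ x)) ≡ b2n (suc x ≡ᵇ y) + b2n (suc y ≡ᵇ x)
      one-side zero zero = refl
      one-side zero (suc zero) = refl
      one-side zero (suc (suc y)) = refl
      one-side (suc x) zero = refl
      one-side (suc x) (suc y) = one-side x y

    deg-r : ∀ b → deg H (m ↑ʳ b) ≡ 1
    deg-r b = trans (deg≡ H _) (trans (sum-↑ m _) (cong₂ _+_
      (trans (sum-cong-≗ λ a → cong b2n (trans (adj-sym H _ _) (trans (adj-lr a b) (does-sym (b ≟F a) (a ≟F b)))))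
        (sum-does-≟ b))
      (sum-zero λ c → cong b2n (adj-rr b c))))
      where
      does-sym : ∀ {a b : Fin m} (d : Dec (b ≡ a)) (e : Dec (a ≡ b)) → does d ≡ does e
      does-sym (yes _) (yes _) = refl
      does-sym (no _) (no _) = refl
      does-sym (yes q) (no ¬q) = contradiction (sym q) ¬q
      does-sym (no ¬q) (yes q) = contradiction (sym q) ¬q

    comb-degrees : ∀ v → 1 ≤ deg H v × deg H v ≤ 3
    comb-degrees = ∀-↑ m _
      (λ a → subst (λ d → 1 ≤ d × d ≤ 3) (sym (deg-l a))
        (m≤n+m 1 _ , +-monoˡ-≤ 1 (+-mono-≤ (b2n≤1 (suc (toℕ a) <ᵇ m)) (b2n≤1 (0 <ᵇ toℕ a)))))
      (λ b → subst (λ d → 1 ≤ d × d ≤ 3) (sym (deg-r b)) (≤-refl , s≤s z≤n))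
      where
      b2n≤1 : ∀ b → b2n b ≤ 1
      b2n≤1 true = ≤-refl
      b2n≤1 false = z≤n

    -- The pendant vertices attain m. The m pendant edges form a perfect matching, and an
    -- independent set has at most one end of each.
    comb-alpha : Alpha H m
    comb-alpha = record
      { set = pendants
      ; nonadjacent = ∀-↑ m _
          (λ a j a∈ → ⊥-elim (path∉ a a∈))
          (λ b → ∀-↑ m _ (λ a _ a∈ → ⊥-elim (path∉ a a∈)) (λ c _ _ → adj-rr b c))
      ; card≡ = trans (sum-↑ m _) (cong₂ _+_
          (sum-zero λ a → cong (λ s → if [ (λ _ → false) , (λ _ → true) ]′ s then 1 else 0) (splitAt-↑ˡ m a m))
          (trans (sum-cong-≗ λ b → cong (λ s → if [ (λ _ → false) , (λ _ → true) ]′ s then 1 else 0) (splitAt-↑ʳ m m b))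
            (trans (sum-const m 1) (*-identityʳ m))))
      ; maximum = λ I ind → ≤-trans (≤-reflexive (trans (sum-↑ m _)
          (sym (∑-distrib-+ (λ a → if I (a ↑ˡ m) then 1 else 0) (λ b → if I (m ↑ʳ b) then 1 else 0)))))
          (≤-trans (sum-mono λ a → matched (I (a ↑ˡ m)) (I (m ↑ʳ a)) λ p q →
              false≢true (trans (sym (ind _ _ p q)) (trans (adj-lr a a) (∈⁅⁆ a))))
            (≤-reflexive (trans (sum-const m 1) (*-identityʳ m))))
      }
      where
      pendants : VSet (m + m)
      pendants i = [ (λ _ → false) , (λ _ → true) ]′ (splitAt m i)
      path∉ : ∀ a → a ↑ˡ m ∈ pendants → ⊥
      path∉ a p rewrite splitAt-↑ˡ m a m with () ← p
      false≢true : false ≢ true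
      false≢true ()
      matched : ∀ b c → (b ≡ true → c ≡ true → ⊥) → (if b then 1 else 0) + (if c then 1 else 0) ≤ 1
      matched true true h = ⊥-elim (h refl refl)
      matched true false h = ≤-refl
      matched false true h = ≤-refl
      matched false false h = z≤n

  ∑deg-comb : ∀ p f → ∑deg (comb (2 + p)) f ≡ f 2 + (p * f 3 + f 2) + (2 + p) * f 1
  ∑deg-comb p f = trans (sum-↑ m (λ v → f (deg (comb m) v))) (cong₂ _+_
    (trans (sum-cong-≗ {m} (λ a → cong f (deg-l a))) (cong (f 2 +_) (inner p (λ b → f (b2n b + 1 + 1)))))
    (trans (sum-cong-≗ {m} (λ b → cong f (deg-r b))) (sum-const m (f 1))))
    where
    m = 2 + p
    open Comb m
    -- Once path vertex 0 is split off, all remaining ones have a predecessor and only the last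
    -- lacks a successor: p of them have degree 3 and one has degree 2.
    inner : ∀ p (g : Bool → ℕ) → sum {1 + p} (λ a → g (toℕ a <ᵇ p)) ≡ p * g true + g false
    inner zero g = +-identityʳ (g false)
    inner (suc p) g = trans (cong (g true +_) (inner p g)) (sym (+-assoc (g true) _ _))

  comb-total : ∀ p {t} → Scale t → ∑deg (comb (2 + p)) (w t) ≡ 7 * (2 + p) + 2 * t
  comb-total p one = trans (∑deg-comb p (w 1)) (rearrange p)
    where
    rearrange : ∀ p → 3 + (p * 2 + 3) + (2 + p) * 5 ≡ 7 * (2 + p) + 2
    rearrange = solve-∀
  comb-total p three = trans (∑deg-comb p (w 3)) (rearrange p)
    where
    rearrange : ∀ p → 3 + (p * 0 + 3) + (2 + p) * 7 ≡ 7 * (2 + p) + 6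
    rearrange = solve-∀

-- Rational arithmetic and interpolation in c₁.

open IndependentSets
open import Data.Integer using (+_)
open import Data.Rational using (ℚ; _≤_; _/_; 1ℚ)
import Data.Integer as ℤ
import Data.Integer.Properties as ℤ
import Data.Nat as ℕ
import Data.Nat.Properties as ℕ
open import Data.Nat.Coprimality using (1-coprimeTo) renaming (sym to coprime-sym)
open import Data.Rational using (mkℚ; *≤*; 0ℚ; ½; _+_; _-_; _*_; -_; nonNegative)
open import Data.Rational.Properties
open import Data.Rational.Solver using (module +-*-Solver)

-- The gcd inside `_/ 1` does not compute for a variable `k`; rewriting to the explicit fraction
-- lets the operations on rationals reduce.
ℕtoℚ≡mkℚ : ∀ k → ℕtoℚ k ≡ mkℚ (+ k) 0 (coprime-sym (1-coprimeTo k))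
ℕtoℚ≡mkℚ k = normalize-coprime (coprime-sym (1-coprimeTo k))

ℕtoℚ-+ : ∀ m k → ℕtoℚ (m ℕ.+ k) ≡ ℕtoℚ m + ℕtoℚ k
ℕtoℚ-+ m k rewrite ℕtoℚ≡mkℚ m | ℕtoℚ≡mkℚ k =
  cong (_/ 1) (sym (cong₂ ℤ._+_ (ℤ.*-identityʳ (+ m)) (ℤ.*-identityʳ (+ k))))

ℕtoℚ-* : ∀ m k → ℕtoℚ (m ℕ.* k) ≡ ℕtoℚ m * ℕtoℚ k
ℕtoℚ-* m k rewrite ℕtoℚ≡mkℚ m | ℕtoℚ≡mkℚ k = cong (_/ 1) (ℤ.pos-* m k)

ℕtoℚ-mono : ∀ {m k} → m ℕ.≤ k → ℕtoℚ m ≤ ℕtoℚ k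
ℕtoℚ-mono {m} {k} m≤k rewrite ℕtoℚ≡mkℚ m | ℕtoℚ≡mkℚ k = *≤* (ℤ.*-monoʳ-≤-nonNeg (+ 1) (ℤ.+≤+ m≤k))

p≤q⇒0≤q-p : ∀ {p q} → p ≤ q → 0ℚ ≤ q - p
p≤q⇒0≤q-p {p} {q} p≤q = subst (_≤ q - p) (+-inverseʳ p) (+-monoˡ-≤ (- p) p≤q)

-- The slack for parameter `t`: at the corresponding end c₁ = (t + 4)/7 it is 7 times the difference
-- between `k` and the bound.
surplus : ℕ → Graph → ℕ → ℚ
surplus t G k = ℕtoℚ (7 ℕ.* k ℕ.+ 2 ℕ.* t) -
  ℕtoℚ (w t 1 ℕ.* numDeg G 1 ℕ.+ w t 2 ℕ.* numDeg G 2 ℕ.+ w t 3 ℕ.* numDeg G 3)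

surplus≡ : ∀ t G k → surplus t G k ≡
  (ℕtoℚ 7 * ℕtoℚ k + ℕtoℚ (2 ℕ.* t)) -
  (ℕtoℚ (w t 1) * ℕtoℚ (numDeg G 1) + ℕtoℚ (w t 2) * ℕtoℚ (numDeg G 2) + ℕtoℚ (w t 3) * ℕtoℚ (numDeg G 3))
surplus≡ t G k = cong₂ _-_
  (trans (ℕtoℚ-+ (7 ℕ.* k) (2 ℕ.* t)) (cong (_+ ℕtoℚ (2 ℕ.* t)) (ℕtoℚ-* 7 k)))
  (trans (ℕtoℚ-+ (w t 1 ℕ.* numDeg G 1 ℕ.+ w t 2 ℕ.* numDeg G 2) (w t 3 ℕ.* numDeg G 3)) (cong₂ _+_
    (trans (ℕtoℚ-+ (w t 1 ℕ.* numDeg G 1) (w t 2 ℕ.* numDeg G 2))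
      (cong₂ _+_ (ℕtoℚ-* (w t 1) (numDeg G 1)) (ℕtoℚ-* (w t 2) (numDeg G 2)))) (ℕtoℚ-* (w t 3) (numDeg G 3))))

-- The bound is affine in c, so its slack at c is the linear interpolation of the slacks at 5/7 and
-- 1. The coefficients are 7/2 · (1 - c) and 7/2 · (c - 5/7), since the ends are 2/7 apart; dividing
-- the surpluses by 7 leaves the factor ½.
interpolation : ∀ c G k →
  bound c G + ((c - + 5 / 7) * (½ * surplus 3 G k) + (1ℚ - c) * (½ * surplus 1 G k)) ≡ ℕtoℚ k
interpolation c G k = trans
  (cong (λ r → bound c G + r) (cong₂ _+_
    (cong (λ s → (c - + 5 / 7) * (½ * s)) (surplus≡ 3 G k))
    (cong (λ s → (1ℚ - c) * (½ * s)) (surplus≡ 1 G k))))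
  (identity c (ℕtoℚ (numDeg G 1)) (ℕtoℚ (numDeg G 2)) (ℕtoℚ (numDeg G 3)) (ℕtoℚ k))
  where
  open +-*-Solver
  identity : ∀ c a b d k →
    (c * a + (+ 3 / 7) * b + (1ℚ - c) * d - (+ 2 / 1 * c - + 8 / 7)) +
    ((c - + 5 / 7) * (½ * ((ℕtoℚ 7 * k + ℕtoℚ 6) - (ℕtoℚ 7 * a + ℕtoℚ 3 * b + ℕtoℚ 0 * d)))
     + (1ℚ - c) * (½ * ((ℕtoℚ 7 * k + ℕtoℚ 2) - (ℕtoℚ 5 * a + ℕtoℚ 3 * b + ℕtoℚ 2 * d)))) ≡ k
  identity = solve 5 (λ c a b d k →
    (c :* a :+ con (+ 3 / 7) :* b :+ (con 1ℚ :- c) :* d :- (con (+ 2 / 1) :* c :- con (+ 8 / 7))) :+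
    ((c :- con (+ 5 / 7)) :* (con ½ :* ((con (ℕtoℚ 7) :* k :+ con (ℕtoℚ 6)) :-
        (con (ℕtoℚ 7) :* a :+ con (ℕtoℚ 3) :* b :+ con (ℕtoℚ 0) :* d)))
     :+ (con 1ℚ :- c) :* (con ½ :* ((con (ℕtoℚ 7) :* k :+ con (ℕtoℚ 2)) :-
        (con (ℕtoℚ 5) :* a :+ con (ℕtoℚ 3) :* b :+ con (ℕtoℚ 2) :* d)))) := k) refl

surplus-nonNeg : ∀ {t G k} → ∑deg G (w t) ℕ.≤ 7 ℕ.* k ℕ.+ 2 ℕ.* t → 0ℚ ≤ surplus t G k
surplus-nonNeg {t} {G} h = p≤q⇒0≤q-p (ℕtoℚ-mono (ℕ.≤-trans (numDeg-≤ G (w t)) h))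

surplus-zero : ∀ {t G k} → (∀ v → 1 ℕ.≤ deg G v × deg G v ℕ.≤ 3) →
  ∑deg G (w t) ≡ 7 ℕ.* k ℕ.+ 2 ℕ.* t → surplus t G k ≡ 0ℚ
surplus-zero {t} {G} {k} degrees eq = trans
  (cong (λ s → ℕtoℚ (7 ℕ.* k ℕ.+ 2 ℕ.* t) - ℕtoℚ s) (trans (numDeg-≡ G (w t) degrees) eq))
  (+-inverseʳ (ℕtoℚ (7 ℕ.* k ℕ.+ 2 ℕ.* t)))

product-nonNeg : ∀ {p q} → 0ℚ ≤ p → 0ℚ ≤ q → 0ℚ ≤ p * q
product-nonNeg {p} {q} 0≤p 0≤q =
  nonNegative⁻¹ (p * q) {{nonNeg*nonNeg⇒nonNeg p {{nonNegative 0≤p}} q {{nonNegative 0≤q}}}}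

bound-≤ : ∀ {c G k} → + 5 / 7 ≤ c → c ≤ 1ℚ → 0ℚ ≤ surplus 3 G k → 0ℚ ≤ surplus 1 G k → bound c G ≤ ℕtoℚ k
bound-≤ {c} {G} {k} 5/7≤c c≤1 s₃ s₁ = subst₂ _≤_ (+-identityʳ (bound c G)) (interpolation c G k)
  (+-monoʳ-≤ (bound c G) (+-mono-≤
    (product-nonNeg (p≤q⇒0≤q-p 5/7≤c) (product-nonNeg (nonNegative⁻¹ ½) s₃))
    (product-nonNeg (p≤q⇒0≤q-p c≤1) (product-nonNeg (nonNegative⁻¹ ½) s₁))))

-- The first hypothesis concerns the whole product so as to fit both classes: for combs the surplus
-- vanishes, for triangle trees the factor c - 5/7 does.
bound-≡ : ∀ {c G k} → (c - + 5 / 7) * (½ * surplus 3 G k) ≡ 0ℚ → surplus 1 G k ≡ 0ℚ → bound c G ≡ ℕtoℚ k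
bound-≡ {c} {G} {k} s₃ s₁ = trans
  (sym (trans (cong (λ r → bound c G + r) (cong₂ _+_ s₃
    (trans (cong (λ s → (1ℚ - c) * (½ * s)) s₁) (*-zeroʳ (1ℚ - c)))))
    (+-identityʳ (bound c G))))
  (interpolation c G k)

theorem8 : (c₁ : ℚ) → + 5 / 7 ≤ c₁ → c₁ ≤ 1ℚ →
    ((G : Graph) → InClassG G → (k : ℕ) → IsAlpha G k → bound c₁ G ≤ ℕtoℚ k)
    × ((G : Graph) → InB G → (k : ℕ) → IsAlpha G k → bound c₁ G ≡ ℕtoℚ k)
    × (c₁ ≡ + 5 / 7 → (G : Graph) → InA G → (k : ℕ) → IsAlpha G k → bound c₁ G ≡ ℕtoℚ k)
theorem8 c₁ 5/7≤c₁ c₁≤1 = lower , combs , triangle-trees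
  where
  lower : ∀ G → InClassG G → ∀ k → IsAlpha G k → bound c₁ G ≤ ℕtoℚ k
  lower G inG k isα = bound-≤ {c₁} {G} {k} 5/7≤c₁ c₁≤1
    (surplus-nonNeg {3} {G} {k} (connected⇒bound three inG (IsAlpha⇒Alpha isα)))
    (surplus-nonNeg {1} {G} {k} (connected⇒bound one inG (IsAlpha⇒Alpha isα)))

  combs : ∀ G → InB G → ∀ k → IsAlpha G k → bound c₁ G ≡ ℕtoℚ k
  combs G (ℕ.suc (ℕ.suc p) , _ , iso) k isα =
    trans (bound-≡ {c₁} {G} {m}
      (trans (cong (λ s → (c₁ - + 5 / 7) * (½ * s)) (no-surplus three)) (*-zeroʳ (c₁ - + 5 / 7)))
      (no-surplus one))
    (cong ℕtoℚ (Alpha-unique (Alpha-iso {G} {H} iso (Comb.comb-alpha m)) (IsAlpha⇒Alpha isα)))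
    where
    m = 2 ℕ.+ p
    H = comb m
    no-surplus : ∀ {t} → Scale t → surplus t G m ≡ 0ℚ
    no-surplus {t} sc = surplus-zero {t} {G} {m}
      (λ v → subst (λ d → 1 ℕ.≤ d × d ℕ.≤ 3) (sym (deg-iso {G} {H} iso v)) (Comb.comb-degrees m (proj₁ iso v)))
      (trans (∑deg-iso {G} {H} iso (w t)) (comb-total p sc))
  combs G (1 , ℕ.s≤s () , iso) k isα

  triangle-trees : c₁ ≡ + 5 / 7 → ∀ G → InA G → ∀ k → IsAlpha G k → bound c₁ G ≡ ℕtoℚ k
  triangle-trees c₁≡5/7 G inA k isα = trans
    (bound-≡ {c₁} {G} {l}
      (trans (cong (_* (½ * surplus 3 G l)) (trans (cong (_- + 5 / 7) c₁≡5/7) (+-inverseʳ (+ 5 / 7))))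
        (*-zeroˡ (½ * surplus 3 G l)))
      (surplus-zero {1} {G} {l} degrees total))
    (cong ℕtoℚ (Alpha-unique alpha (IsAlpha⇒Alpha isα)))
    where open TriangleTree (InA⇒TriangleTree inA) renaming (k to l)
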